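{- (a) If $S$ is a B-stable (respectively BI-stable) proper subset of $\mathbb{Z}^2$, then every subset of $S$ is B-stable (respectively BI-stable). (b) If $S$ is an I-stable subset of $\mathbb{Z}^2$ that is not the image under a unimodular transformation of $J_{1/4}$, $J_{1/2}$, or $\mathbb{Z}^2$, then every subset of $S$ is I-stable. (c) Every B-stable (respectively I-stable, BI-stable) proper subset of $\mathbb{Z}^2$ is contained in a maximal B-stable (respectively I-stable, BI-stable) set. (d) There exist non-periodic maximal B-stable sets, non-periodic maximal I-stable sets, and non-periodic maximal BI-stable sets.
   Context: A lattice triangle is the convex hull in $\mathbb{R}^2$ of three non-collinear points of $\mathbb{Z}^2$. A triangle is a set $T = \Delta \cap \mathbb{Z}^2$ for a lattice triangle $\Delta$. A triangle is minimal if it contains exactly $4$ points of $\mathbb{Z}^2$; a minimal triangle is a border triangle if its non-vertex point lies on the boundary of $\Delta$, and an internal triangle if that point lies in the interior of $\Delta$. A set $S \subseteq \mathbb{Z}^2$ is B-stable if no border triangle has exactly three of its points in $S$; I-stable if no internal triangle has exactly three of its points in $S$; BI-stable if both. A maximal B-stable (resp. I-stable, BI-stable) set is a B-stable (resp. I-stable, BI-stable) proper subset $S \subsetneq \mathbb{Z}^2$ such that no B-stable (resp. I-stable, BI-stable) proper subset of $\mathbb{Z}^2$ properly contains $S$. A set is periodic if it is of the form $X + k\mathbb{Z}^2$ for some finite $X \subset \mathbb{Z}^2$ and positive integer $k$. A unimodular transformation is a map $x \mapsto Mx + b$ with $M$ an integer $2\times 2$ matrix of determinant $\pm1$ and $b\in\mathbb{Z}^2$.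 Let $\Delta_0 = \{(0,0),(1,0),(0,1),(-1,-1)\}$, $J_{1/4} = \Delta_0 + 4\mathbb{Z}^2$ and $J_{1/2} = J_{1/4} \cup (J_{1/4} + (2,2))$. -}

module Defs where

open import Level using (0ℓ)
open import Data.Integer using (ℤ; +_; -_; _+_; _-_; _*_; _≤_; _<_; 0ℤ; 1ℤ; -1ℤ)
open import Data.Nat as ℕ using (ℕ)
open import Data.Product using (_×_; _,_; Σ; ∃; ∃-syntax)
open import Data.Sum using (_⊎_)
open import Data.List using (List; []; _∷_)
open import Data.List.Membership.Propositional using (_∈_)
open import Relation.Binary.PropositionalEquality using (_≡_; _≢_)
open import Relation.Nullary using (¬_)
open import Relation.Unary using (Pred; _⊆_; _≐_)

Point : Set
Point = ℤ × ℤ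

_⊕_ : Point → Point → Point
(a , b) ⊕ (c , d) = (a + c , b + d)

_⊖_ : Point → Point → Point
(a , b) ⊖ (c , d) = (a - c , b - d)

_·_ : ℤ → Point → Point
k · (a , b) = (k * a , k * b)

Subset : Set₁
Subset = Pred Point 0ℓ

Full : Subset
Full _ = Point

Proper : Subset → Set
Proper S = ∃[ p ] ¬ S p

det2 : Point → Point → ℤ
det2 (x₁ , y₁) (x₂ , y₂) = x₁ * y₂ - x₂ * y₁

orient : Point → Point → Point → ℤ
orient a b p = det2 (b ⊖ a) (p ⊖ a)

NonCollinear : Point → Point → Point → Set
NonCollinear a b c = orient a b c ≢ 0ℤ

-- p lies in the (closed) convex hull of the lattice triangle a b c:
-- each edge orientation is zero or has the same sign as orient a b c
InTri : Point → Point → Point → Point → Set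
InTri a b c p =
  (0ℤ ≤ orient a b c * orient a b p) ×
  (0ℤ ≤ orient a b c * orient b c p) ×
  (0ℤ ≤ orient a b c * orient c a p)

InInterior : Point → Point → Point → Point → Set
InInterior a b c p =
  (0ℤ < orient a b c * orient a b p) ×
  (0ℤ < orient a b c * orient b c p) ×
  (0ℤ < orient a b c * orient c a p)

OnBoundary : Point → Point → Point → Point → Set
OnBoundary a b c p = InTri a b c p × ¬ InInterior a b c p

IsMinimal : Point → Point → Point → Point → Set
IsMinimal a b c d =
  NonCollinear a b c × InTri a b c d × d ≢ a × d ≢ b × d ≢ c ×
  (∀ p → InTri a b c p → (p ≡ a) ⊎ (p ≡ b) ⊎ (p ≡ c) ⊎ (p ≡ d))

IsBorder : Point → Point → Point → Point → Set
IsBorder a b c d = IsMinimal a b c d × OnBoundary a b c d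

IsInternal : Point → Point → Point → Point → Set
IsInternal a b c d = IsMinimal a b c d × InInterior a b c d

ExactlyThree : Subset → Point → Point → Point → Point → Set
ExactlyThree S a b c d =
  (¬ S a × S b × S c × S d) ⊎
  (S a × ¬ S b × S c × S d) ⊎
  (S a × S b × ¬ S c × S d) ⊎
  (S a × S b × S c × ¬ S d)

BStable : Subset → Set
BStable S = ∀ a b c d → IsBorder a b c d → ¬ ExactlyThree S a b c d

IStable : Subset → Set
IStable S = ∀ a b c d → IsInternal a b c d → ¬ ExactlyThree S a b c d

BIStable : Subset → Set
BIStable S = BStable S × IStable S

Maximal : (Subset → Set) → Subset → Set₁
Maximal St S =
  St S × Proper S ×
  (∀ (S′ : Subset) → St S′ → Proper S′ → S ⊆ S′ → ¬ (∃[ p ] (S′ p × ¬ S p)))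

Periodic : Subset → Set
Periodic S =
  Σ (List Point) λ X → Σ ℕ λ k → (0 ℕ.< k) ×
    (S ≐ (λ p → ∃[ x ] ∃[ v ] ((x ∈ X) × (p ≡ x ⊕ ((+ k) · v)))))

record Unimodular : Set where
  field
    m₁₁ m₁₂ m₂₁ m₂₂ : ℤ
    shift : Point
    det±1 : (m₁₁ * m₂₂ - m₁₂ * m₂₁ ≡ 1ℤ) ⊎ (m₁₁ * m₂₂ - m₁₂ * m₂₁ ≡ -1ℤ)

applyU : Unimodular → Point → Point
applyU U (x , y) = (m₁₁ * x + m₁₂ * y , m₂₁ * x + m₂₂ * y) ⊕ shift
  where open Unimodular U

image : Unimodular → Subset → Subset
image U X y = ∃[ x ] (X x × applyU U x ≡ y)

UnimodImage : Subset → Subset → Set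
UnimodImage X S = Σ Unimodular λ U → S ≐ image U X

Δ₀ : List Point
Δ₀ = (0ℤ , 0ℤ) ∷ (1ℤ , 0ℤ) ∷ (0ℤ , 1ℤ) ∷ (-1ℤ , -1ℤ) ∷ []

J¼ : Subset
J¼ p = ∃[ q ] ∃[ v ] ((q ∈ Δ₀) × (p ≡ q ⊕ ((+ 4) · v)))

J½ : Subset
J½ p = J¼ p ⊎ J¼ (p ⊖ (+ 2 , + 2))

{-# OPTIONS --safe #-}
-- Up to unimodular maps there is one border triangle, with midpoint (0,0), ends ±(1,0) and apex
-- (0,1), and one internal triangle, Δ₀: an empty lattice triangle has determinant ±1, and a minimal
-- triangle a b c is cut by its fourth point d into empty triangles.
--
-- Under the border rule three points spanning a unimodular triangle generate ℤ², so a proper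
-- B-stable set contains no three points of a border triangle, and of an internal one in the BI case.
-- Under the internal rule Δ₀ generates J¼; a further point generates a coset of J¼ that completes it
-- to an image of J½; and any point outside J½ generates ℤ². Hence, except for these sets, I-stable
-- sets too are free of three points of an internal triangle. Freeness is hereditary and of finite
-- character, so a greedy enumeration of ℤ² extends free sets to maximal ones, while J½ is maximal
-- because it is stable and any further point generates ℤ².
--
-- For (d), a free set is chosen so that, for every k, some translate of (0,0) by kℤ² would generate
-- ℤ² together with the set: no stable proper extension is periodic.
module Submission where

open import Defs
open import Level using (0ℓ)
open import Axiom.ExcludedMiddle using (ExcludedMiddle)
open import Data.Bool using (Bool; true; false; not; _xor_)
import Data.Bool.Properties as Bool
open import Data.Empty using (⊥; ⊥-elim)
open import Data.Fin as Fin using (Fin; toℕ)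
open import Data.Fin.Patterns using (0F; 1F; 2F; 3F)
import Data.Fin.Properties as Finₚ
open import Data.Integer as ℤ using (ℤ; +_; -[1+_]; -_; _+_; _-_; _*_; 0ℤ; 1ℤ; -1ℤ; ∣_∣; _≤_; _<_; +≤+; +<+)
open import Data.Integer.DivMod using (_%ℕ_; _/ℕ_; a≡a%ℕn+[a/ℕn]*n; n%ℕd<d)
open import Data.Integer.Properties as ℤₚ using (abs-*; +-identityˡ; +-identityʳ; *-identityˡ; *-comm; +-assoc; +-inverseʳ; +-injective)
open import Data.Integer.Solver using (module +-*-Solver)
open import Data.List.Membership.Propositional using (_∈_)
open import Data.List.Relation.Unary.Any using (here; there)
open import Data.Nat as ℕ using (ℕ; zero; suc; z≤n; s≤s)
open import Data.Nat.Properties as ℕₚ using (m*n≡1⇒m≡1)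
open import Data.Product using (_×_; _,_; proj₁; proj₂; Σ; ∃-syntax)
open import Data.Sum using (_⊎_; inj₁; inj₂; [_,_]′)
open import Function using (_∘_)
open import Relation.Binary.Definitions using (tri<; tri≈; tri>)
open import Relation.Binary.PropositionalEquality
open import Relation.Nullary using (¬_; Dec; yes; no)
open import Relation.Nullary.Decidable using (toWitness; _→-dec_; _×-dec_; ¬?)
open import Relation.Unary using (_⊆_; _≐_)
open +-*-Solver using (Polynomial; solve; con; _:+_; _:*_; _:-_; :-_; _:=_)

-- The number 4 comes from the fact that `Δ₀` represents every class modulo 2 exactly once: the
-- translates of `J¼` by (0,0), (2,2), (0,2) and (2,0) therefore partition the plane. Linear
-- symmetries of `Δ₀` permute the last three, so an extension of `J¼` by a point need only be
-- studied in the translate by (2,2). The triangle with vertices (-1,0), (0,-1), (1,1) and centre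
-- (0,0) meets each of the four translates once, so two translates besides `J¼` force the third.
-- Aperiodicity is arranged by determinants. Three points of a border or internal triangle have
-- determinant ±1, ±2 or ±3, or they are an edge with its midpoint. Congruences, and in the internal
-- case one bound on size, keep the chosen set free of such triples, while its origin is placed so
-- that a translate of it by a multiple of any period falls among points with which it forms one. In
-- the internal case such a triple yields only a copy of `J¼`; two more points, in two further
-- translates, then reach the whole plane.

-- Affine maps of the lattice

-- Symbolic points and operations on them, for goals of the ring solver.
Pointᵖ : ℕ → Set
Pointᵖ n = Polynomial n × Polynomial n

module _ {n : ℕ} where

  det2ᵖ : Pointᵖ n → Pointᵖ n → Polynomial n
  det2ᵖ (x₁ , y₁) (x₂ , y₂) = x₁ :* y₂ :- x₂ :* y₁

  _⊕ᵖ_ _⊖ᵖ_ : Pointᵖ n → Pointᵖ n → Pointᵖ n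
  (a , b) ⊕ᵖ (c , d) = a :+ c , b :+ d
  (a , b) ⊖ᵖ (c , d) = a :- c , b :- d

  _·ᵖ_ : ℤ → Pointᵖ n → Pointᵖ n
  k ·ᵖ (a , b) = con k :* a , con k :* b

  orientᵖ : Pointᵖ n → Pointᵖ n → Pointᵖ n → Polynomial n
  orientᵖ a b c = det2ᵖ (b ⊖ᵖ a) (c ⊖ᵖ a)

-- A square equal to 1, rather than a choice between 1 and -1, suits the ring solver and treats both
-- orientations at once; on numerals `unit refl` is checked by evaluation.
record Unit (z : ℤ) : Set where
  constructor unit
  field square : z * z ≡ 1ℤ

Unit-neg : ∀ {z} → Unit z → Unit (- z)
Unit-neg {z} (unit p) = unit (trans (solve 1 (λ z → (:- z) :* (:- z) := z :* z) refl z) p)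

Unit-* : ∀ {y z} → Unit y → Unit z → Unit (y * z)
Unit-* {y} {z} (unit p) (unit q) = unit
  (trans (solve 2 (λ y z → (y :* z) :* (y :* z) := (y :* y) :* (z :* z)) refl y z) (cong₂ _*_ p q))

Unit⇒±1 : ∀ z → Unit z → z ≡ 1ℤ ⊎ z ≡ -1ℤ
Unit⇒±1 z (unit u) with z | m*n≡1⇒m≡1 ∣ z ∣ ∣ z ∣ (trans (sym (abs-* z z)) (cong ∣_∣ u))
... | + 1        | refl = inj₁ refl
... | -[1+ 0 ]   | refl = inj₂ refl

±1⇒Unit : ∀ {z} → z ≡ 1ℤ ⊎ z ≡ -1ℤ → Unit z
±1⇒Unit (inj₁ refl) = unit refl
±1⇒Unit (inj₂ refl) = unit refl

-- The inner point of an internal triangle is its centroid: `a + b + c = 3 d`. Solved for `c`, the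
-- equation lets a match on `refl` eliminate that point; `Internal-swap` and `Internal-rotate`
-- restore the symmetry.
record Internal (a b c d : Point) : Set where
  constructor internal
  field
    internal-unit  : Unit (orient d a b)
    internal-third : c ≡ (((+ 3) · d) ⊖ a) ⊖ b

-- The vertices a, b are the ends of the edge with midpoint d, and c is the apex.
record Border (a b c d : Point) : Set where
  constructor border
  field
    border-unit     : Unit (orient d c a)
    border-opposite : b ≡ ((+ 2) · d) ⊖ a

orient-swap : ∀ d a b → orient d b a ≡ - orient d a b
orient-swap (d₁ , d₂) (a₁ , a₂) (b₁ , b₂) =
  solve 6 (λ d₁ d₂ a₁ a₂ b₁ b₂ → let a = a₁ , a₂ ; b = b₁ , b₂ ; d = d₁ , d₂ in
    orientᵖ d b a := :- orientᵖ d a b) refl d₁ d₂ a₁ a₂ b₁ b₂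

orient-rotate : ∀ d a b → orient a b d ≡ orient d a b
orient-rotate (d₁ , d₂) (a₁ , a₂) (b₁ , b₂) =
  solve 6 (λ d₁ d₂ a₁ a₂ b₁ b₂ → let a = a₁ , a₂ ; b = b₁ , b₂ ; d = d₁ , d₂ in
    orientᵖ a b d := orientᵖ d a b) refl d₁ d₂ a₁ a₂ b₁ b₂

Internal-swap : ∀ {a b c d} → Internal a b c d → Internal b a c d
Internal-swap {a₁ , a₂} {b₁ , b₂} {_} {d₁ , d₂} (internal u refl) =
  internal (subst Unit (sym (orient-swap (d₁ , d₂) (a₁ , a₂) (b₁ , b₂))) (Unit-neg u))
    (cong₂ _,_ (comm d₁ a₁ b₁) (comm d₂ a₂ b₂))
  where
  comm : ∀ d a b → (+ 3 * d - a) - b ≡ (+ 3 * d - b) - a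
  comm = solve 3 (λ d a b → (con (+ 3) :* d :- a) :- b := (con (+ 3) :* d :- b) :- a) refl

-- As `c - d` is the negative of `(a - d) + (b - d)`, the three triangles at the centroid have equal
-- determinants.
Internal-rotate : ∀ {a b c d} → Internal a b c d → Internal b c a d
Internal-rotate {a₁ , a₂} {b₁ , b₂} {_} {d₁ , d₂} (internal u refl) =
  internal (subst Unit (solve 6 (λ d₁ d₂ a₁ a₂ b₁ b₂ → let a = a₁ , a₂ ; b = b₁ , b₂ ; d = d₁ , d₂ in
      orientᵖ d a b := orientᵖ d b ((((+ 3) ·ᵖ d) ⊖ᵖ a) ⊖ᵖ b)) refl d₁ d₂ a₁ a₂ b₁ b₂) u)
    (cong₂ _,_ (back d₁ a₁ b₁) (back d₂ a₂ b₂))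
  where
  back : ∀ d a b → a ≡ (+ 3 * d - b) - ((+ 3 * d - a) - b)
  back = solve 3 (λ d a b → a := (con (+ 3) :* d :- b) :- ((con (+ 3) :* d :- a) :- b)) refl

Border-swap : ∀ {a b c d} → Border a b c d → Border b a c d
Border-swap {a₁ , a₂} {_} {c₁ , c₂} {d₁ , d₂} (border u refl) =
  border (subst Unit (solve 6 (λ d₁ d₂ a₁ a₂ c₁ c₂ → let a = a₁ , a₂ ; c = c₁ , c₂ ; d = d₁ , d₂ in
      :- orientᵖ d c a := orientᵖ d c (((+ 2) ·ᵖ d) ⊖ᵖ a)) refl d₁ d₂ a₁ a₂ c₁ c₂)
    (Unit-neg u))
    (cong₂ _,_ (back d₁ a₁) (back d₂ a₂))
  where
  back : ∀ d a → a ≡ + 2 * d - (+ 2 * d - a)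
  back = solve 2 (λ d a → a := con (+ 2) :* d :- (con (+ 2) :* d :- a)) refl

record Matrixᵖ (n : ℕ) : Set where
  constructor mat
  field a b c d e f : Polynomial n

module _ {n : ℕ} where
  applyᵖ : Matrixᵖ n → Pointᵖ n → Pointᵖ n
  applyᵖ (mat a b c d e f) (x , y) = (a :* x :+ b :* y) :+ e , (c :* x :+ d :* y) :+ f

  detᵖ : Matrixᵖ n → Polynomial n
  detᵖ (mat a b c d _ _) = a :* d :- b :* c

det : Unimodular → ℤ
det U = m₁₁ * m₂₂ - m₁₂ * m₂₁
  where open Unimodular U

det-unit : ∀ U → Unit (det U)
det-unit U = ±1⇒Unit (Unimodular.det±1 U)

mkU : ∀ a b c d → Point → Unit (a * d - b * c) → Unimodular
mkU a b c d t u = record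
  { m₁₁ = a ; m₁₂ = b ; m₂₁ = c ; m₂₂ = d ; shift = t ; det±1 = Unit⇒±1 _ u }

orient-U : ∀ U p q r → orient (applyU U p) (applyU U q) (applyU U r) ≡ det U * orient p q r
orient-U U (p₁ , p₂) (q₁ , q₂) (r₁ , r₂) =
  solve 12 (λ a b c d e f p₁ p₂ q₁ q₂ r₁ r₂ →
      let M = mat a b c d e f ; p = p₁ , p₂ ; q = q₁ , q₂ ; r = r₁ , r₂ in
      orientᵖ (applyᵖ M p) (applyᵖ M q) (applyᵖ M r) := detᵖ M :* orientᵖ p q r)
    refl m₁₁ m₁₂ m₂₁ m₂₂ (proj₁ shift) (proj₂ shift) p₁ p₂ q₁ q₂ r₁ r₂
  where open Unimodular U

Internal-U : ∀ U {a b c d} → Internal a b c d →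
             Internal (applyU U a) (applyU U b) (applyU U c) (applyU U d)
Internal-U U {a} {b} {_} {d} (internal u refl) =
  internal (subst Unit (sym (orient-U U d a b)) (Unit-* (det-unit U) u))
    (cong₂ _,_ (affine m₁₁ m₁₂ (proj₁ shift) _ _ _ _ _ _) (affine m₂₁ m₂₂ (proj₂ shift) _ _ _ _ _ _))
  where
  open Unimodular U
  affine : ∀ m n s d₁ d₂ a₁ a₂ b₁ b₂ →
    (m * ((+ 3 * d₁ - a₁) - b₁) + n * ((+ 3 * d₂ - a₂) - b₂)) + s ≡
    (+ 3 * ((m * d₁ + n * d₂) + s) - ((m * a₁ + n * a₂) + s)) - ((m * b₁ + n * b₂) + s)
  affine = solve 9 (λ m n s d₁ d₂ a₁ a₂ b₁ b₂ →
    (m :* ((con (+ 3) :* d₁ :- a₁) :- b₁) :+ n :* ((con (+ 3) :* d₂ :- a₂) :- b₂)) :+ s :=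
    (con (+ 3) :* ((m :* d₁ :+ n :* d₂) :+ s) :- ((m :* a₁ :+ n :* a₂) :+ s))
      :- ((m :* b₁ :+ n :* b₂) :+ s)) refl

Border-U : ∀ U {a b c d} → Border a b c d →
           Border (applyU U a) (applyU U b) (applyU U c) (applyU U d)
Border-U U {a} {_} {c} {d} (border u refl) =
  border (subst Unit (sym (orient-U U d c a)) (Unit-* (det-unit U) u))
    (cong₂ _,_ (affine m₁₁ m₁₂ (proj₁ shift) _ _ _ _) (affine m₂₁ m₂₂ (proj₂ shift) _ _ _ _))
  where
  open Unimodular U
  affine : ∀ m n s d₁ d₂ a₁ a₂ →
    (m * (+ 2 * d₁ - a₁) + n * (+ 2 * d₂ - a₂)) + s ≡
    + 2 * ((m * d₁ + n * d₂) + s) - ((m * a₁ + n * a₂) + s)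
  affine = solve 7 (λ m n s d₁ d₂ a₁ a₂ →
    (m :* (con (+ 2) :* d₁ :- a₁) :+ n :* (con (+ 2) :* d₂ :- a₂)) :+ s :=
    con (+ 2) :* ((m :* d₁ :+ n :* d₂) :+ s) :- ((m :* a₁ :+ n :* a₂) :+ s)) refl

_∘ᵁ_ : Unimodular → Unimodular → Unimodular
U ∘ᵁ V = mkU (a * A + b * C) (a * B + b * D) (c * A + d * C) (c * B + d * D)
             (applyU U (Unimodular.shift V))
             (subst Unit (sym (multiplicative a b c d A B C D))
               (Unit-* (det-unit U) (det-unit V)))
  where
  open Unimodular U renaming (m₁₁ to a; m₁₂ to b; m₂₁ to c; m₂₂ to d)
  open Unimodular V using () renaming (m₁₁ to A; m₁₂ to B; m₂₁ to C; m₂₂ to D)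
  multiplicative : ∀ a b c d A B C D →
    (a * A + b * C) * (c * B + d * D) - (a * B + b * D) * (c * A + d * C) ≡
    (a * d - b * c) * (A * D - B * C)
  multiplicative = solve 8 (λ a b c d A B C D →
    (a :* A :+ b :* C) :* (c :* B :+ d :* D) :- (a :* B :+ b :* D) :* (c :* A :+ d :* C) :=
    (a :* d :- b :* c) :* (A :* D :- B :* C)) refl

applyU-∘ : ∀ U V p → applyU (U ∘ᵁ V) p ≡ applyU U (applyU V p)
applyU-∘ U V (x , y) = cong₂ _,_
  (row (m₁₁ U) (m₁₂ U) (proj₁ (shift U)) (m₁₁ V) (m₁₂ V) (m₂₁ V) (m₂₂ V) _ _ x y)
  (row (m₂₁ U) (m₂₂ U) (proj₂ (shift U)) (m₁₁ V) (m₁₂ V) (m₂₁ V) (m₂₂ V) _ _ x y)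
  where
  open Unimodular
  row : ∀ a b s A B C D S T x y →
    ((a * A + b * C) * x + (a * B + b * D) * y) + ((a * S + b * T) + s) ≡
    (a * ((A * x + B * y) + S) + b * ((C * x + D * y) + T)) + s
  row = solve 11 (λ a b s A B C D S T x y →
    ((a :* A :+ b :* C) :* x :+ (a :* B :+ b :* D) :* y) :+ ((a :* S :+ b :* T) :+ s) :=
    (a :* ((A :* x :+ B :* y) :+ S) :+ b :* ((C :* x :+ D :* y) :+ T)) :+ s) refl

module Inverse (U : Unimodular) where
  open Unimodular U renaming (m₁₁ to a; m₁₂ to b; m₂₁ to c; m₂₂ to d)
  private
    s = proj₁ shift
    t = proj₂ shift
    δ = det U

  -- Since `δ * δ` is 1, multiplying by `δ` amounts to dividing by it, and the inverse matrix is `δ`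
  -- times the adjugate. The ring solver cannot use that equation, so the compositions below are
  -- normalised to contain the factor `δ * δ`, which `cancel` and `cancel′` remove.
  inverse : Unimodular
  inverse = mkU (δ * d) (- (δ * b)) (- (δ * c)) (δ * a)
    (- (δ * (d * s - b * t)) , - (δ * (a * t - c * s)))
    (subst Unit (solve 5 (λ a b c d δ →
        (δ :* δ) :* (a :* d :- b :* c) := (δ :* d) :* (δ :* a) :- (:- (δ :* b)) :* (:- (δ :* c)))
        refl a b c d δ)
      (Unit-* (Unit-* (det-unit U) (det-unit U)) (det-unit U)))

  private
    cancel : ∀ x s → (δ * δ) * (x - s) + s ≡ x
    cancel x s = trans (cong (λ e → e * (x - s) + s) (Unit.square (det-unit U)))
                       (solve 2 (λ x s → con 1ℤ :* (x :- s) :+ s := x) refl x s)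

    cancel′ : ∀ x → (δ * δ) * x ≡ x
    cancel′ x = trans (cong (_* x) (Unit.square (det-unit U))) (*-identityˡ x)

  applyU-inverseʳ : ∀ p → applyU U (applyU inverse p) ≡ p
  applyU-inverseʳ (x , y) = cong₂ _,_
    (trans (solve 8 (λ a b c d s t x y → let δ = a :* d :- b :* c in
        (a :* (((δ :* d) :* x :+ (:- (δ :* b)) :* y) :+ :- (δ :* (d :* s :- b :* t)))
        :+ b :* (((:- (δ :* c)) :* x :+ (δ :* a) :* y) :+ :- (δ :* (a :* t :- c :* s)))) :+ s
        := (δ :* δ) :* (x :- s) :+ s) refl a b c d s t x y) (cancel x s))
    (trans (solve 8 (λ a b c d s t x y → let δ = a :* d :- b :* c in
        (c :* (((δ :* d) :* x :+ (:- (δ :* b)) :* y) :+ :- (δ :* (d :* s :- b :* t)))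
        :+ d :* (((:- (δ :* c)) :* x :+ (δ :* a) :* y) :+ :- (δ :* (a :* t :- c :* s)))) :+ t
        := (δ :* δ) :* (y :- t) :+ t) refl a b c d s t x y) (cancel y t))

  applyU-inverseˡ : ∀ p → applyU inverse (applyU U p) ≡ p
  applyU-inverseˡ (x , y) = cong₂ _,_
    (trans (solve 8 (λ a b c d s t x y → let δ = a :* d :- b :* c in
        ((δ :* d) :* ((a :* x :+ b :* y) :+ s) :+ (:- (δ :* b)) :* ((c :* x :+ d :* y) :+ t))
          :+ :- (δ :* (d :* s :- b :* t))
        := (δ :* δ) :* x) refl a b c d s t x y) (cancel′ x))
    (trans (solve 8 (λ a b c d s t x y → let δ = a :* d :- b :* c in
        ((:- (δ :* c)) :* ((a :* x :+ b :* y) :+ s) :+ (δ :* a) :* ((c :* x :+ d :* y) :+ t))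
          :+ :- (δ :* (a :* t :- c :* s))
        := (δ :* δ) :* y) refl a b c d s t x y) (cancel′ y))

open Inverse public using (inverse; applyU-inverseʳ; applyU-inverseˡ)

-- Pulling a set back along this map turns any unimodular triangle into the standard one, so that
-- the generation arguments deal with numerals only.
frame : ∀ d a b → Unit (orient d a b) → Unimodular
frame d a b u = mkU (proj₁ (a ⊖ d)) (proj₁ (b ⊖ d)) (proj₂ (a ⊖ d)) (proj₂ (b ⊖ d)) d u

module _ (d a b : Point) (u : Unit (orient d a b)) where
  private
    F = applyU (frame d a b u)

  frame-00 : F (0ℤ , 0ℤ) ≡ d
  frame-00 = cong₂ _,_ (eq (proj₁ d) (proj₁ a) (proj₁ b)) (eq (proj₂ d) (proj₂ a) (proj₂ b))
    where
    eq : ∀ d a b → ((a - d) * 0ℤ + (b - d) * 0ℤ) + d ≡ d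
    eq = solve 3 (λ d a b → ((a :- d) :* con 0ℤ :+ (b :- d) :* con 0ℤ) :+ d := d) refl

  frame-10 : F (1ℤ , 0ℤ) ≡ a
  frame-10 = cong₂ _,_ (eq (proj₁ d) (proj₁ a) (proj₁ b)) (eq (proj₂ d) (proj₂ a) (proj₂ b))
    where
    eq : ∀ d a b → ((a - d) * 1ℤ + (b - d) * 0ℤ) + d ≡ a
    eq = solve 3 (λ d a b → ((a :- d) :* con 1ℤ :+ (b :- d) :* con 0ℤ) :+ d := a) refl

  frame-01 : F (0ℤ , 1ℤ) ≡ b
  frame-01 = cong₂ _,_ (eq (proj₁ d) (proj₁ a) (proj₁ b)) (eq (proj₂ d) (proj₂ a) (proj₂ b))
    where
    eq : ∀ d a b → ((a - d) * 0ℤ + (b - d) * 1ℤ) + d ≡ b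
    eq = solve 3 (λ d a b → ((a :- d) :* con 0ℤ :+ (b :- d) :* con 1ℤ) :+ d := b) refl

  frame-third : F (-1ℤ , -1ℤ) ≡ (((+ 3) · d) ⊖ a) ⊖ b
  frame-third = cong₂ _,_ (eq (proj₁ d) (proj₁ a) (proj₁ b)) (eq (proj₂ d) (proj₂ a) (proj₂ b))
    where
    eq : ∀ d a b → ((a - d) * -1ℤ + (b - d) * -1ℤ) + d ≡ (+ 3 * d - a) - b
    eq = solve 3 (λ d a b → ((a :- d) :* con -1ℤ :+ (b :- d) :* con -1ℤ) :+ d
                            := (con (+ 3) :* d :- a) :- b) refl

  frame-opposite : F (-1ℤ , 0ℤ) ≡ ((+ 2) · d) ⊖ a
  frame-opposite = cong₂ _,_ (eq (proj₁ d) (proj₁ a) (proj₁ b)) (eq (proj₂ d) (proj₂ a) (proj₂ b))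
    where
    eq : ∀ d a b → ((a - d) * -1ℤ + (b - d) * 0ℤ) + d ≡ + 2 * d - a
    eq = solve 3 (λ d a b → ((a :- d) :* con -1ℤ :+ (b :- d) :* con 0ℤ) :+ d
                            := con (+ 2) :* d :- a) refl

-- Closed sets

-- The positive form of stability: it produces the missing point, whereas `IStable` only refutes its
-- absence. The two agree under excluded middle, and derivations by these rules are constructive.
-- One `corner` rule serves all three vertices by rotation.
record IClosed (P : Subset) : Set where
  field
    centre : ∀ {a b c d} → Internal a b c d → P a → P b → P c → P d
    corner : ∀ {a b c d} → Internal a b c d → P a → P b → P d → P c

  third : ∀ {a b d} → Unit (orient d a b) → P a → P b → P d → P ((((+ 3) · d) ⊖ a) ⊖ b)
  third u = corner (internal u refl)

open IClosed

record BClosed (P : Subset) : Set where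
  field
    apex     : ∀ {a b c d} → Border a b c d → P a → P b → P d → P c
    endpoint : ∀ {a b c d} → Border a b c d → P a → P c → P d → P b
    midpoint : ∀ {a b c d} → Border a b c d → P a → P b → P c → P d

open BClosed

IClosed-U : ∀ {P} U → IClosed P → IClosed (P ∘ applyU U)
IClosed-U U cl = record { centre = centre cl ∘ Internal-U U ; corner = corner cl ∘ Internal-U U }

BClosed-U : ∀ {P} U → BClosed P → BClosed (P ∘ applyU U)
BClosed-U U cl = record
  { apex = apex cl ∘ Border-U U
  ; endpoint = endpoint cl ∘ Border-U U
  ; midpoint = midpoint cl ∘ Border-U U }

IClosed-resp : ∀ {P Q} → P ≐ Q → IClosed P → IClosed Q
IClosed-resp (P⊆Q , Q⊆P) cl = record
  { centre = λ i a b c → P⊆Q (centre cl i (Q⊆P a) (Q⊆P b) (Q⊆P c))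
  ; corner = λ i a b d → P⊆Q (corner cl i (Q⊆P a) (Q⊆P b) (Q⊆P d)) }

BClosed-resp : ∀ {P Q} → P ≐ Q → BClosed P → BClosed Q
BClosed-resp (P⊆Q , Q⊆P) cl = record
  { apex = λ i a b d → P⊆Q (apex cl i (Q⊆P a) (Q⊆P b) (Q⊆P d))
  ; endpoint = λ i a c d → P⊆Q (endpoint cl i (Q⊆P a) (Q⊆P c) (Q⊆P d))
  ; midpoint = λ i a b c → P⊆Q (midpoint cl i (Q⊆P a) (Q⊆P b) (Q⊆P c)) }

translate : Subset → Point → Subset
translate P t p = P (p ⊕ t)

translation : Point → Unimodular
translation t = mkU 1ℤ 0ℤ 0ℤ 1ℤ t (unit refl)

translation-⊕ : ∀ t p → applyU (translation t) p ≡ p ⊕ t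
translation-⊕ (s , t) (x , y) = cong₂ _,_
  (solve 3 (λ x y s → (con 1ℤ :* x :+ con 0ℤ :* y) :+ s := x :+ s) refl x y s)
  (solve 3 (λ x y s → (con 0ℤ :* x :+ con 1ℤ :* y) :+ s := y :+ s) refl x y t)

translate-≐ : ∀ P t → P ∘ applyU (translation t) ≐ translate P t
translate-≐ P t = (λ {p} → subst P (translation-⊕ t p)) , (λ {p} → subst P (sym (translation-⊕ t p)))

IClosed-translate : ∀ {P} t → IClosed P → IClosed (translate P t)
IClosed-translate {P} t = IClosed-resp (translate-≐ P t) ∘ IClosed-U (translation t)

BClosed-translate : ∀ {P} t → BClosed P → BClosed (translate P t)
BClosed-translate {P} t = BClosed-resp (translate-≐ P t) ∘ BClosed-U (translation t)

-- Spreading a configuration by translations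

ℤ-induction : (R : ℤ → Set) → R 0ℤ → (∀ z → R z → R (1ℤ + z)) → (∀ z → R z → R (-1ℤ + z)) → ∀ z → R z
ℤ-induction R r₀ up down (+ zero)        = r₀
ℤ-induction R r₀ up down (+ suc n)       = up (+ n) (ℤ-induction R r₀ up down (+ n))
ℤ-induction R r₀ up down (-[1+ zero ])   = down 0ℤ r₀
ℤ-induction R r₀ up down (-[1+ suc n ]) = down -[1+ n ] (ℤ-induction R r₀ up down -[1+ n ])

-- The four steps are stated at the origin; as `C` is invariant under translation, they can be
-- repeated at every place reached. The border rule uses this with `k = 1`, the internal rule with
-- `k = 4`.
module Spread
  (C F : Subset → Set)
  (C-translate : ∀ {P} t → C P → C (translate P t))
  (F-mono : ∀ {P Q} → P ⊆ Q → F P → F Q)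
  (k : ℤ)
  (right : ∀ {P} → C P → F P → F (translate P (k · (1ℤ , 0ℤ))))
  (left  : ∀ {P} → C P → F P → F (translate P (k · (-1ℤ , 0ℤ))))
  (up    : ∀ {P} → C P → F P → F (translate P (k · (0ℤ , 1ℤ))))
  (down  : ∀ {P} → C P → F P → F (translate P (k · (0ℤ , -1ℤ))))
  where

  spread : ∀ {P} → C P → F P → ∀ v → F (translate P (k · v))
  spread {P} cp fp (x , y) =
    -- The walk climbs the column of 0 and then follows the row of `y`. A horizontal step leaves
    -- `0ℤ + y`, which does not reduce for a variable `y`; `zero-y` repairs this.
    ℤ-induction (λ x → Q (x , y))
      (ℤ-induction (λ y → Q (0ℤ , y)) base (λ y → step up 0ℤ y) (λ y → step down 0ℤ y) y)
      (λ x q → F-mono (λ {p} → subst P (zero-y (1ℤ + x) p)) (step right x y q))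
      (λ x q → F-mono (λ {p} → subst P (zero-y (-1ℤ + x) p)) (step left x y q)) x
    where
    Q : Point → Set
    Q v = F (translate P (k · v))

    base : Q (0ℤ , 0ℤ)
    base = F-mono (λ {p} → subst P (sym (cong₂ _,_ (eq (proj₁ p)) (eq (proj₂ p))))) fp
      where
      eq : ∀ x → x + k * 0ℤ ≡ x
      eq x = solve 2 (λ x k → x :+ k :* con 0ℤ := x) refl x k

    step : ∀ {e} → (∀ {P} → C P → F P → F (translate P (k · e))) → ∀ x y → Q (x , y) → Q (e ⊕ (x , y))
    step {e₁ , e₂} f x y q = F-mono (λ {p} → subst P (cong₂ _,_ (eq (proj₁ p) e₁ x) (eq (proj₂ p) e₂ y)))
                               (f (C-translate (k · (x , y)) cp) q)
      where
      eq : ∀ p e v → (p + k * e) + k * v ≡ p + k * (e + v)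
      eq p e v = solve 4 (λ p e v k → (p :+ k :* e) :+ k :* v := p :+ k :* (e :+ v)) refl p e v k

    zero-y : ∀ x p → p ⊕ (k · (x , 0ℤ + y)) ≡ p ⊕ (k · (x , y))
    zero-y x p = cong (λ y → p ⊕ (k · (x , y))) (+-identityˡ y)

-- Generation under the border rule

TriangleIn : Subset → Set
TriangleIn P = P (0ℤ , 0ℤ) × P (1ℤ , 0ℤ) × P (0ℤ , 1ℤ)

-- From an edge and its midpoint, `apex` yields every lattice point on the two nearest parallel
-- lines: the ends (1,0) and (-1,0) with midpoint (0,0) give (1,1) here, and (-1,1) and (1,-1)
-- below.
TriangleIn-right : ∀ {P} → BClosed P → TriangleIn P → TriangleIn (translate P (+ 1 , + 0))
TriangleIn-right cl (o , e₁ , e₂) =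
  e₁ , endpoint cl (border (unit refl) refl) o e₂ e₁ ,
  apex cl (border (unit refl) refl) e₁ (endpoint cl (border (unit refl) refl) e₁ e₂ o) o

TriangleIn-left : ∀ {P} → BClosed P → TriangleIn P → TriangleIn (translate P (-1ℤ , + 0))
TriangleIn-left {P} cl (o , e₁ , e₂) = −e₁ , o , apex cl (border (unit refl) refl) e₁ −e₁ o
  where
  −e₁ : P (-1ℤ , 0ℤ)
  −e₁ = endpoint cl (border (unit refl) refl) e₁ e₂ o

TriangleIn-up : ∀ {P} → BClosed P → TriangleIn P → TriangleIn (translate P (+ 0 , + 1))
TriangleIn-up cl (o , e₁ , e₂) =
  e₂ , apex cl (border (unit refl) refl) e₁ (endpoint cl (border (unit refl) refl) e₁ e₂ o) o ,
  endpoint cl (border (unit refl) refl) o e₁ e₂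

TriangleIn-down : ∀ {P} → BClosed P → TriangleIn P → TriangleIn (translate P (+ 0 , -1ℤ))
TriangleIn-down {P} cl (o , e₁ , e₂) =
  apex cl (border (unit refl) refl) e₁ −e₁ o , apex cl (border (unit refl) refl) e₁ −e₁ o , o
  where
  −e₁ : P (-1ℤ , 0ℤ)
  −e₁ = endpoint cl (border (unit refl) refl) e₁ e₂ o

TriangleIn-full : ∀ {P} → BClosed P → TriangleIn P → ∀ p → P p
TriangleIn-full {P} cl t p = subst P (cong₂ _,_ (eq (proj₁ p)) (eq (proj₂ p))) (proj₁ (spread cl t p))
  where
  open Spread BClosed TriangleIn (λ {P} → BClosed-translate {P}) (λ f (a , b , c) → f a , f b , f c) (+ 1)
    TriangleIn-right TriangleIn-left TriangleIn-up TriangleIn-down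
  eq : ∀ x → 0ℤ + + 1 * x ≡ x
  eq = solve 1 (λ x → con 0ℤ :+ con (+ 1) :* x := x) refl

unit-triangle-full : ∀ {P a b d} → BClosed P → Unit (orient d a b) → P a → P b → P d → ∀ p → P p
unit-triangle-full {P} {a} {b} {d} cl u pa pb pd p =
  subst P (applyU-inverseʳ U p) (TriangleIn-full {P ∘ applyU U} (BClosed-U U cl)
    (subst P (sym (frame-00 d a b u)) pd , subst P (sym (frame-10 d a b u)) pa , subst P (sym (frame-01 d a b u)) pb)
    (applyU (inverse U) p))
  where
  U : Unimodular
  U = frame d a b u

-- Generation under the internal rule

ΔIn : Subset → Set
ΔIn P = P (0ℤ , 0ℤ) × P (1ℤ , 0ℤ) × P (0ℤ , 1ℤ) × P (-1ℤ , -1ℤ)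

pattern ∈₀ = here refl
pattern ∈₁ = there (here refl)
pattern ∈₂ = there (there (here refl))
pattern ∈₃ = there (there (there (here refl)))

J¼-0 : ∀ v → J¼ ((0ℤ , 0ℤ) ⊕ ((+ 4) · v))
J¼-0 v = _ , v , ∈₀ , refl

J¼-1 : ∀ v → J¼ ((1ℤ , 0ℤ) ⊕ ((+ 4) · v))
J¼-1 v = _ , v , ∈₁ , refl

J¼-2 : ∀ v → J¼ ((0ℤ , 1ℤ) ⊕ ((+ 4) · v))
J¼-2 v = _ , v , ∈₂ , refl

J¼-3 : ∀ v → J¼ ((-1ℤ , -1ℤ) ⊕ ((+ 4) · v))
J¼-3 v = _ , v , ∈₃ , refl

-- Only the rule for a vertex is used: each line takes `a`, `b`, `d` to `3 d - a - b`. The detours,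
-- for instance through (-4,-3) and (5,4), stay inside `J¼` and end in the copy of `Δ₀` at (4,0).
ΔIn-right : ∀ {P} → IClosed P → ΔIn P → ΔIn (translate P (+ 4 , + 0))
ΔIn-right {P} cl (p⟨0,0⟩ , p⟨1,0⟩ , p⟨0,1⟩ , p⟨−1,−1⟩) =
  p⟨4,0⟩ , p⟨5,0⟩ , p⟨4,1⟩ , p⟨3,−1⟩
  where
  p⟨3,−1⟩ : P (+ 3 , -[1+ 0 ])
  p⟨3,−1⟩ = third cl (unit refl) p⟨0,0⟩ p⟨0,1⟩ p⟨1,0⟩
  p⟨−4,−3⟩ : P (-[1+ 3 ] , -[1+ 2 ])
  p⟨−4,−3⟩ = third cl (unit refl) p⟨0,0⟩ p⟨1,0⟩ p⟨−1,−1⟩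
  p⟨5,4⟩ : P (+ 5 , + 4)
  p⟨5,4⟩ = third cl (unit refl) p⟨−1,−1⟩ p⟨−4,−3⟩ p⟨0,0⟩
  p⟨4,1⟩ : P (+ 4 , + 1)
  p⟨4,1⟩ = third cl (unit refl) p⟨0,0⟩ p⟨−1,−1⟩ p⟨1,0⟩
  p⟨4,0⟩ : P (+ 4 , + 0)
  p⟨4,0⟩ = third cl (unit refl) p⟨3,−1⟩ p⟨5,4⟩ p⟨4,1⟩
  p⟨−4,1⟩ : P (-[1+ 3 ] , + 1)
  p⟨−4,1⟩ = third cl (unit refl) p⟨1,0⟩ p⟨3,−1⟩ p⟨0,0⟩
  p⟨7,−1⟩ : P (+ 7 , -[1+ 0 ])
  p⟨7,−1⟩ = third cl (unit refl) p⟨0,0⟩ p⟨−4,1⟩ p⟨1,0⟩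
  p⟨5,0⟩ : P (+ 5 , + 0)
  p⟨5,0⟩ = third cl (unit refl) p⟨0,1⟩ p⟨7,−1⟩ p⟨4,0⟩

ΔIn-left : ∀ {P} → IClosed P → ΔIn P → ΔIn (translate P (-[1+ 3 ] , + 0))
ΔIn-left {P} cl (p⟨0,0⟩ , p⟨1,0⟩ , p⟨0,1⟩ , p⟨−1,−1⟩) =
  p⟨−4,0⟩ , p⟨−3,0⟩ , p⟨−4,1⟩ , p⟨−5,−1⟩
  where
  p⟨4,1⟩ : P (+ 4 , + 1)
  p⟨4,1⟩ = third cl (unit refl) p⟨0,0⟩ p⟨−1,−1⟩ p⟨1,0⟩
  p⟨−5,−1⟩ : P (-[1+ 4 ] , -[1+ 0 ])
  p⟨−5,−1⟩ = third cl (unit refl) p⟨1,0⟩ p⟨4,1⟩ p⟨0,0⟩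
  p⟨3,−1⟩ : P (+ 3 , -[1+ 0 ])
  p⟨3,−1⟩ = third cl (unit refl) p⟨0,0⟩ p⟨0,1⟩ p⟨1,0⟩
  p⟨−4,1⟩ : P (-[1+ 3 ] , + 1)
  p⟨−4,1⟩ = third cl (unit refl) p⟨1,0⟩ p⟨3,−1⟩ p⟨0,0⟩
  p⟨−1,3⟩ : P (-[1+ 0 ] , + 3)
  p⟨−1,3⟩ = third cl (unit refl) p⟨0,0⟩ p⟨1,0⟩ p⟨0,1⟩
  p⟨4,−4⟩ : P (+ 4 , -[1+ 3 ])
  p⟨4,−4⟩ = third cl (unit refl) p⟨0,1⟩ p⟨−1,3⟩ p⟨1,0⟩
  p⟨−3,0⟩ : P (-[1+ 2 ] , + 0)
  p⟨−3,0⟩ = third cl (unit refl) p⟨−4,1⟩ p⟨4,−4⟩ p⟨−1,−1⟩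
  p⟨−4,0⟩ : P (-[1+ 3 ] , + 0)
  p⟨−4,0⟩ = third cl (unit refl) p⟨0,1⟩ p⟨−5,−1⟩ p⟨−3,0⟩

-- Every triangle used has two points in `J¼` and the given point as its third, so each missing
-- point of the copy of `Δ₀` takes a single step.
ΔIn-2,2 : ∀ {P} → IClosed P → J¼ ⊆ P → ∀ {q} → q ∈ Δ₀ → P (q ⊕ (+ 2 , + 2)) →
          ΔIn (translate P (+ 2 , + 2))
ΔIn-2,2 {P} cl j ∈₀ s =
  s , p⟨3,2⟩ , p⟨2,3⟩ , p⟨1,1⟩
  where
  p⟨3,2⟩ : P (+ 3 , + 2)
  p⟨3,2⟩ = third cl (unit refl) (j (J¼-3 (-[1+ 0 ] , + 0))) s (j (J¼-2 (+ 0 , + 0)))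
  p⟨2,3⟩ : P (+ 2 , + 3)
  p⟨2,3⟩ = third cl (unit refl) (j (J¼-3 (+ 0 , -[1+ 0 ]))) s (j (J¼-1 (+ 0 , + 0)))
  p⟨1,1⟩ : P (+ 1 , + 1)
  p⟨1,1⟩ = centre cl (internal (unit refl) refl) (j (J¼-2 (-[1+ 0 ] , -[1+ 0 ]))) (j (J¼-1 (+ 1 , + 1))) s
ΔIn-2,2 {P} cl j ∈₁ s =
  p⟨2,2⟩ , s , p⟨2,3⟩ , p⟨1,1⟩
  where
  p⟨2,2⟩ : P (+ 2 , + 2)
  p⟨2,2⟩ = third cl (unit refl) (j (J¼-3 (-[1+ 0 ] , + 0))) s (j (J¼-2 (+ 0 , + 0)))
  p⟨2,3⟩ : P (+ 2 , + 3)
  p⟨2,3⟩ = centre cl (internal (unit refl) refl) (j (J¼-0 (+ 0 , + 1))) (j (J¼-3 (+ 1 , + 1))) s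
  p⟨1,1⟩ : P (+ 1 , + 1)
  p⟨1,1⟩ = third cl (unit refl) (j (J¼-2 (-[1+ 0 ] , -[1+ 0 ]))) s (j (J¼-0 (+ 0 , + 0)))
ΔIn-2,2 {P} cl j ∈₂ s =
  p⟨2,2⟩ , p⟨3,2⟩ , s , p⟨1,1⟩
  where
  p⟨2,2⟩ : P (+ 2 , + 2)
  p⟨2,2⟩ = third cl (unit refl) (j (J¼-3 (+ 0 , -[1+ 0 ]))) s (j (J¼-1 (+ 0 , + 0)))
  p⟨3,2⟩ : P (+ 3 , + 2)
  p⟨3,2⟩ = third cl (unit refl) (j (J¼-0 (+ 0 , + 1))) (j (J¼-3 (+ 1 , + 1))) s
  p⟨1,1⟩ : P (+ 1 , + 1)
  p⟨1,1⟩ = third cl (unit refl) (j (J¼-1 (-[1+ 0 ] , -[1+ 0 ]))) s (j (J¼-0 (+ 0 , + 0)))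
ΔIn-2,2 {P} cl j ∈₃ s =
  p⟨2,2⟩ , p⟨3,2⟩ , p⟨2,3⟩ , s
  where
  p⟨2,2⟩ : P (+ 2 , + 2)
  p⟨2,2⟩ = third cl (unit refl) (j (J¼-2 (-[1+ 0 ] , -[1+ 0 ]))) (j (J¼-1 (+ 1 , + 1))) s
  p⟨3,2⟩ : P (+ 3 , + 2)
  p⟨3,2⟩ = third cl (unit refl) (j (J¼-2 (-[1+ 0 ] , -[1+ 0 ]))) s (j (J¼-0 (+ 0 , + 0)))
  p⟨2,3⟩ : P (+ 2 , + 3)
  p⟨2,3⟩ = third cl (unit refl) (j (J¼-1 (-[1+ 0 ] , -[1+ 0 ]))) s (j (J¼-0 (+ 0 , + 0)))
-- `Δ₀` is symmetric about the diagonal, so the vertical steps are the horizontal ones for the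
-- reflected set, with the roles of (1,0) and (0,1) exchanged.
reflection : Unimodular
reflection = mkU 0ℤ 1ℤ 1ℤ 0ℤ (0ℤ , 0ℤ) (unit refl)

ΔIn-reflection : ∀ {P} → ΔIn P → ΔIn (P ∘ applyU reflection)
ΔIn-reflection (o , e₁ , e₂ , e₃) = o , e₂ , e₁ , e₃

ΔIn-up : ∀ {P} → IClosed P → ΔIn P → ΔIn (translate P (+ 0 , + 4))
ΔIn-up {P} cl Δ = swap (ΔIn-right {P ∘ applyU reflection} (IClosed-U reflection cl) (ΔIn-reflection {P} Δ))
  where
  swap : ΔIn (translate (P ∘ applyU reflection) (+ 4 , 0ℤ)) → ΔIn (translate P (0ℤ , + 4))
  swap (o , e₁ , e₂ , e₃) = o , e₂ , e₁ , e₃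

ΔIn-down : ∀ {P} → IClosed P → ΔIn P → ΔIn (translate P (+ 0 , -[1+ 3 ]))
ΔIn-down {P} cl Δ = swap (ΔIn-left {P ∘ applyU reflection} (IClosed-U reflection cl) (ΔIn-reflection {P} Δ))
  where
  swap : ΔIn (translate (P ∘ applyU reflection) (-[1+ 3 ] , 0ℤ)) → ΔIn (translate P (0ℤ , -[1+ 3 ]))
  swap (o , e₁ , e₂ , e₃) = o , e₂ , e₁ , e₃

J¼-fill : ∀ {P} → IClosed P → ΔIn P → J¼ ⊆ P
J¼-fill {P} cl Δ (q , v , q∈Δ₀ , refl) = pick q∈Δ₀ (spread cl Δ v)
  where
  open Spread IClosed ΔIn (λ {P} → IClosed-translate {P}) (λ f (a , b , c , d) → f a , f b , f c , f d) (+ 4)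
    ΔIn-right ΔIn-left ΔIn-up ΔIn-down
  pick : q ∈ Δ₀ → ΔIn (translate P ((+ 4) · v)) → translate P ((+ 4) · v) q
  pick ∈₀                         (o , e₁ , e₂ , e₃) = o
  pick ∈₁                 (o , e₁ , e₂ , e₃) = e₁
  pick ∈₂         (o , e₁ , e₂ , e₃) = e₂
  pick ∈₃ (o , e₁ , e₂ , e₃) = e₃

-- This is `J¼` shifted by `t`, as an indexed family: a match on it determines the point, which the
-- existential form of `J¼` leaves to an equation.
data Coset (t : Point) : Point → Set where
  point : ∀ {q} v → q ∈ Δ₀ → Coset t ((q ⊕ t) ⊕ ((+ 4) · v))


Coset⇒J¼ : ∀ {t p} → Coset t p → J¼ (p ⊖ t)
Coset⇒J¼ {t₁ , t₂} (point {q₁ , q₂} v@(w₁ , w₂) q∈Δ₀) = _ , v , q∈Δ₀ , cong₂ _,_ (eq q₁ t₁ w₁) (eq q₂ t₂ w₂)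
  where
  eq : ∀ q t v → ((q + t) + + 4 * v) - t ≡ q + + 4 * v
  eq = solve 3 (λ q t v → ((q :+ t) :+ con (+ 4) :* v) :- t := q :+ con (+ 4) :* v) refl

J¼⇒Coset : ∀ t p → J¼ (p ⊖ t) → Coset t p
J¼⇒Coset t@(t₁ , t₂) (x , y) ((q₁ , q₂) , v@(w₁ , w₂) , q∈Δ₀ , eq) =
  subst (Coset t) (sym (cong₂ _,_ (move x t₁ q₁ w₁ (cong proj₁ eq)) (move y t₂ q₂ w₂ (cong proj₂ eq)))) (point v q∈Δ₀)
  where
  move : ∀ x t q v → x - t ≡ q + + 4 * v → x ≡ (q + t) + + 4 * v
  move x t q v e = trans (solve 2 (λ x t → x := (x :- t) :+ t) refl x t)
    (trans (cong (_+ t) e) (solve 3 (λ q t v → (q :+ con (+ 4) :* v) :+ t := (q :+ t) :+ con (+ 4) :* v) refl q t v))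

Coset-translate : ∀ {t p} v → Coset t p → Coset t (p ⊕ ((+ 4) · v))
Coset-translate {t@(t₁ , t₂)} v@(x , y) (point {q@(q₁ , q₂)} w@(w₁ , w₂) q∈Δ₀) =
  subst (Coset t) (cong₂ _,_ (eq (q₁ + t₁) w₁ x) (eq (q₂ + t₂) w₂ y)) (point (w ⊕ v) q∈Δ₀)
  where
  eq : ∀ x w v → x + + 4 * (w + v) ≡ (x + + 4 * w) + + 4 * v
  eq = solve 3 (λ x w v → x :+ con (+ 4) :* (w :+ v) := (x :+ con (+ 4) :* w) :+ con (+ 4) :* v) refl

-0ℤ : ∀ x → x - 0ℤ ≡ x
-0ℤ = solve 1 (λ x → x :- con 0ℤ := x) refl

J¼⊆Coset-0 : J¼ ⊆ Coset (0ℤ , 0ℤ)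
J¼⊆Coset-0 {p@(x , y)} = J¼⇒Coset _ p ∘ subst J¼ (sym (cong₂ _,_ (-0ℤ x) (-0ℤ y)))

Coset-0⊆J¼ : Coset (0ℤ , 0ℤ) ⊆ J¼
Coset-0⊆J¼ {x , y} = subst J¼ (cong₂ _,_ (-0ℤ x) (-0ℤ y)) ∘ Coset⇒J¼

J¼-translate : ∀ v → J¼ ⊆ translate J¼ ((+ 4) · v)
J¼-translate v = Coset-0⊆J¼ ∘ Coset-translate v ∘ J¼⊆Coset-0

-- A shift by a multiple of 4 preserves `J¼` and brings the known point into the copy of `Δ₀` at
-- (2,2); `ΔIn-2,2` completes that copy and `J¼-fill` spreads it.
Coset-22-fill : ∀ {P} → IClosed P → J¼ ⊆ P → ∀ {p} → Coset (+ 2 , + 2) p → P p → Coset (+ 2 , + 2) ⊆ P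
Coset-22-fill {P} cl J⊆P (point v@(x , y) q∈Δ₀) pp (point {r₁ , r₂} (w₁ , w₂) r∈Δ₀) =
  subst P (cong₂ _,_ (eq r₁ w₁ x) (eq r₂ w₂ y))
    (J¼-fill (IClosed-translate (+ 2 , + 2) clᵥ)
      (ΔIn-2,2 clᵥ (J⊆P ∘ J¼-translate v) q∈Δ₀ pp)
      (_ , (w₁ - x , w₂ - y) , r∈Δ₀ , refl))
  where
  clᵥ : IClosed (translate P ((+ 4) · v))
  clᵥ = IClosed-translate ((+ 4) · v) cl
  eq : ∀ r w v → ((r + + 4 * (w - v)) + + 2) + + 4 * v ≡ (r + + 2) + + 4 * w
  eq = solve 3 (λ r w v → ((r :+ con (+ 4) :* (w :- v)) :+ con (+ 2)) :+ con (+ 4) :* v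
                          := (r :+ con (+ 2)) :+ con (+ 4) :* w) refl

module _ (U : Unimodular) (Δ₀-stable : ∀ {q} → q ∈ Δ₀ → applyU U q ∈ Δ₀) where
  open Unimodular U

  -- The equation says that the linear part of `U` takes `t` to `t′` modulo 4. Since `U` maps `Δ₀`
  -- into itself, it respects the decomposition of a point into an element of `Δ₀`, the shift and a
  -- multiple of 4.
  Coset-U : ∀ t t′ w → applyU U t ≡ (shift ⊕ t′) ⊕ ((+ 4) · w) → Coset t ⊆ Coset t′ ∘ applyU U
  Coset-U t@(t₁ , t₂) t′@(t₁′ , t₂′) (w₁ , w₂) e (point {q₁ , q₂} (v₁ , v₂) q∈Δ₀) =
    subst (Coset t′)
      (cong₂ _,_ (eq m₁₁ m₁₂ (proj₁ shift) t₁′ w₁ (cong proj₁ e)) (eq m₂₁ m₂₂ (proj₂ shift) t₂′ w₂ (cong proj₂ e)))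
      (point ((m₁₁ * v₁ + m₁₂ * v₂ , m₂₁ * v₁ + m₂₂ * v₂) ⊕ (w₁ , w₂)) (Δ₀-stable q∈Δ₀))
    where
    eq : ∀ m n s t′ w → (m * t₁ + n * t₂) + s ≡ (s + t′) + + 4 * w →
         (((m * q₁ + n * q₂) + s) + t′) + + 4 * ((m * v₁ + n * v₂) + w) ≡
         (m * ((q₁ + t₁) + + 4 * v₁) + n * ((q₂ + t₂) + + 4 * v₂)) + s
    eq m n s t′ w e =
      trans (solve 8 (λ m n s t′ w q₁ q₂ z →
              (((m :* q₁ :+ n :* q₂) :+ s) :+ t′) :+ con (+ 4) :* (z :+ w) :=
              ((s :+ t′) :+ con (+ 4) :* w) :+ ((m :* q₁ :+ n :* q₂) :+ con (+ 4) :* z)) refl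
              m n s t′ w q₁ q₂ (m * v₁ + n * v₂))
      (trans (cong (_+ ((m * q₁ + n * q₂) + + 4 * (m * v₁ + n * v₂))) (sym e))
             (solve 9 (λ m n s q₁ q₂ v₁ v₂ t₁ t₂ →
               ((m :* t₁ :+ n :* t₂) :+ s) :+ ((m :* q₁ :+ n :* q₂) :+ con (+ 4) :* (m :* v₁ :+ n :* v₂)) :=
               (m :* ((q₁ :+ t₁) :+ con (+ 4) :* v₁) :+ n :* ((q₂ :+ t₂) :+ con (+ 4) :* v₂)) :+ s) refl
               m n s q₁ q₂ v₁ v₂ t₁ t₂))

-- The linear involutions of Δ₀ that fix (1,0), respectively (0,1).
κ₁ κ₂ : Unimodular
κ₁ = mkU 1ℤ -1ℤ 0ℤ -1ℤ (0ℤ , 0ℤ) (unit refl)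
κ₂ = mkU -1ℤ 0ℤ -1ℤ 1ℤ (0ℤ , 0ℤ) (unit refl)

κ₁-involutive : ∀ p → applyU κ₁ (applyU κ₁ p) ≡ p
κ₁-involutive = applyU-inverseʳ κ₁

κ₂-involutive : ∀ p → applyU κ₂ (applyU κ₂ p) ≡ p
κ₂-involutive = applyU-inverseʳ κ₂

κ₁-Δ₀ : ∀ {q} → q ∈ Δ₀ → applyU κ₁ q ∈ Δ₀
κ₁-Δ₀ ∈₀                         = ∈₀
κ₁-Δ₀ ∈₁                 = ∈₁
κ₁-Δ₀ ∈₂         = ∈₃
κ₁-Δ₀ ∈₃ = ∈₂

κ₂-Δ₀ : ∀ {q} → q ∈ Δ₀ → applyU κ₂ q ∈ Δ₀
κ₂-Δ₀ ∈₀                         = ∈₀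
κ₂-Δ₀ ∈₁                 = ∈₃
κ₂-Δ₀ ∈₂         = ∈₂
κ₂-Δ₀ ∈₃ = ∈₁

J¼-κ₁ : J¼ ⊆ J¼ ∘ applyU κ₁
J¼-κ₁ = Coset-0⊆J¼ ∘ Coset-U κ₁ κ₁-Δ₀ _ _ (0ℤ , 0ℤ) refl ∘ J¼⊆Coset-0

J¼-κ₂ : J¼ ⊆ J¼ ∘ applyU κ₂
J¼-κ₂ = Coset-0⊆J¼ ∘ Coset-U κ₂ κ₂-Δ₀ _ _ (0ℤ , 0ℤ) refl ∘ J¼⊆Coset-0

Coset-κ₁ : Coset (+ 0 , + 2) ⊆ Coset (+ 2 , + 2) ∘ applyU κ₁
Coset-κ₁ = Coset-U κ₁ κ₁-Δ₀ (+ 0 , + 2) (+ 2 , + 2) (-1ℤ , -1ℤ) refl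

Coset-κ₂ : Coset (+ 2 , + 0) ⊆ Coset (+ 2 , + 2) ∘ applyU κ₂
Coset-κ₂ = Coset-U κ₂ κ₂-Δ₀ (+ 2 , + 0) (+ 2 , + 2) (-1ℤ , -1ℤ) refl

-- The involution carries this coset to the one at (2,2), so the case already settled applies to the
-- pulled-back set. The conclusion stays in pulled-back form, as `J¼-extend` has to exhibit `J½` in
-- it.
Coset-02-fill : ∀ {P} → IClosed P → J¼ ⊆ P → ∀ {p} → Coset (+ 0 , + 2) p → P p →
                Coset (+ 2 , + 2) ⊆ P ∘ applyU κ₁
Coset-02-fill {P} cl J⊆P {p} c pp =
  Coset-22-fill (IClosed-U κ₁ cl) (J⊆P ∘ J¼-κ₁) (Coset-κ₁ c) (subst P (sym (κ₁-involutive p)) pp)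

Coset-20-fill : ∀ {P} → IClosed P → J¼ ⊆ P → ∀ {p} → Coset (+ 2 , + 0) p → P p →
                Coset (+ 2 , + 2) ⊆ P ∘ applyU κ₂
Coset-20-fill {P} cl J⊆P {p} c pp =
  Coset-22-fill (IClosed-U κ₂ cl) (J⊆P ∘ J¼-κ₂) (Coset-κ₂ c) (subst P (sym (κ₂-involutive p)) pp)

data Coset4 (p : Point) : Set where
  c00 : J¼ p → Coset4 p
  c22 : Coset (+ 2 , + 2) p → Coset4 p
  c02 : Coset (+ 0 , + 2) p → Coset4 p
  c20 : Coset (+ 2 , + 0) p → Coset4 p

Coset4-translate : ∀ {p} v → Coset4 p → Coset4 (p ⊕ ((+ 4) · v))
Coset4-translate v (c00 c) = c00 (J¼-translate v c)
Coset4-translate v (c22 c) = c22 (Coset-translate v c)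
Coset4-translate v (c02 c) = c02 (Coset-translate v c)
Coset4-translate v (c20 c) = c20 (Coset-translate v c)

data Mod4 : ℤ → Set where
  residue : ∀ (r : Fin 4) k → Mod4 (+ toℕ r + + 4 * k)

mod4 : ∀ x → Mod4 x
mod4 x = subst Mod4 (sym eq) (residue (Fin.fromℕ< (n%ℕd<d x 4)) (x /ℕ 4))
  where
  open import Data.Fin.Properties using (toℕ-fromℕ<)
  eq : x ≡ + toℕ (Fin.fromℕ< (n%ℕd<d x 4)) + + 4 * (x /ℕ 4)
  eq = trans (a≡a%ℕn+[a/ℕn]*n x 4)
             (cong₂ (λ r m → + r + m) (sym (toℕ-fromℕ< (n%ℕd<d x 4))) (*-comm (x /ℕ 4) (+ 4)))

-- The four shifts are the classes of even vectors modulo 4, and `Δ₀` represents each class modulo 2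
-- once; together they reach all sixteen classes modulo 4.
coset4 : ∀ p → Coset4 p
coset4 (x , y) with mod4 x | mod4 y
... | residue r k | residue s l = Coset4-translate (k , l) (representative r s)
  where
  representative : ∀ r s → Coset4 (+ toℕ r , + toℕ s)
  representative 0F 0F = c00 (J¼-0 (0ℤ , 0ℤ))
  representative 0F 1F = c00 (J¼-2 (0ℤ , 0ℤ))
  representative 0F 2F = c02 (point (0ℤ , 0ℤ) ∈₀)
  representative 0F 3F = c02 (point (0ℤ , 0ℤ) ∈₂)
  representative 1F 0F = c00 (J¼-1 (0ℤ , 0ℤ))
  representative 1F 1F = c22 (point (0ℤ , 0ℤ) ∈₃)
  representative 1F 2F = c02 (point (0ℤ , 0ℤ) ∈₁)
  representative 1F 3F = c20 (point (0ℤ , 1ℤ) ∈₃)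
  representative 2F 0F = c20 (point (0ℤ , 0ℤ) ∈₀)
  representative 2F 1F = c20 (point (0ℤ , 0ℤ) ∈₂)
  representative 2F 2F = c22 (point (0ℤ , 0ℤ) ∈₀)
  representative 2F 3F = c22 (point (0ℤ , 0ℤ) ∈₂)
  representative 3F 0F = c20 (point (0ℤ , 0ℤ) ∈₁)
  representative 3F 1F = c02 (point (1ℤ , 0ℤ) ∈₃)
  representative 3F 2F = c22 (point (0ℤ , 0ℤ) ∈₁)
  representative 3F 3F = c00 (J¼-3 (1ℤ , 1ℤ))

three-cosets-full : ∀ {P} → IClosed P → J¼ ⊆ P → Coset (+ 2 , + 2) ⊆ P → ∀ {p q} →
                    Coset (+ 0 , + 2) p → P p → Coset (+ 2 , + 0) q → P q → ∀ x → P x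
three-cosets-full {P} cl J⊆P C⊆P cp pp cq pq x with coset4 x
... | c00 c = J⊆P c
... | c22 c = C⊆P c
... | c02 c = subst P (κ₁-involutive x) (Coset-02-fill cl J⊆P cp pp (Coset-κ₁ c))
... | c20 c = subst P (κ₂-involutive x) (Coset-20-fill cl J⊆P cq pq (Coset-κ₂ c))

-- The triangle (0,-1), (1,1), (-1,0) with centre (0,0) has its centre in `J¼` and one vertex in
-- each other coset. As (1,1) lies in `J½`, filling the coset of `p` supplies a second vertex, and
-- the third then lies in the last coset.
J½-extend : ∀ {P} → IClosed P → J½ ⊆ P → ∀ {p} → P p → ¬ J½ p → ∀ x → P x
J½-extend {P} cl J⊆P {p} pp p∉J = by-coset (coset4 p)
  where
  J¼⊆P : J¼ ⊆ P
  J¼⊆P c = J⊆P (inj₁ c)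

  C⊆P : Coset (+ 2 , + 2) ⊆ P
  C⊆P c = J⊆P (inj₂ (Coset⇒J¼ c))

  p⟨0,0⟩ : P (0ℤ , 0ℤ)
  p⟨0,0⟩ = J¼⊆P (J¼-0 (0ℤ , 0ℤ))

  c⟨1,1⟩ : Coset (+ 2 , + 2) (1ℤ , 1ℤ)
  c⟨1,1⟩ = point (0ℤ , 0ℤ) ∈₃

  by-coset : Coset4 p → ∀ x → P x
  by-coset (c00 c) = ⊥-elim (p∉J (inj₁ c))
  by-coset (c22 c) = ⊥-elim (p∉J (inj₂ (Coset⇒J¼ c)))
  by-coset (c02 c) = three-cosets-full cl J¼⊆P C⊆P c pp (point (-1ℤ , 0ℤ) ∈₁)
    (third cl (unit refl) p⟨0,−1⟩ (C⊆P c⟨1,1⟩) p⟨0,0⟩)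
    where
    p⟨0,−1⟩ : P (0ℤ , -1ℤ)
    p⟨0,−1⟩ = Coset-02-fill cl J¼⊆P c pp c⟨1,1⟩
  by-coset (c20 c) = three-cosets-full cl J¼⊆P C⊆P (point (0ℤ , -1ℤ) ∈₂)
    (third cl (unit refl) p⟨−1,0⟩ (C⊆P c⟨1,1⟩) p⟨0,0⟩) c pp
    where
    p⟨−1,0⟩ : P (-1ℤ , 0ℤ)
    p⟨−1,0⟩ = Coset-20-fill cl J¼⊆P c pp c⟨1,1⟩

-- The identity, `κ₁` and `κ₂` correspond to the three cosets in which the new point can lie; the
-- identity is represented by the translation by zero.
J¼-extend : ∀ {P} → IClosed P → J¼ ⊆ P → ∀ {p} → P p → ¬ J¼ p →
            ∃[ U ] (J½ ⊆ P ∘ applyU U)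
J¼-extend {P} cl J⊆P {p} pp p∉J with coset4 p
... | c00 c = ⊥-elim (p∉J c)
... | c22 c = translation (0ℤ , 0ℤ) , λ {x} → subst P (sym (translation-0 x)) ∘
                λ { (inj₁ c′) → J⊆P c′ ; (inj₂ c′) → Coset-22-fill cl J⊆P c pp (J¼⇒Coset _ x c′) }
  where
  translation-0 : ∀ x → applyU (translation (0ℤ , 0ℤ)) x ≡ x
  translation-0 (x , y) = trans (translation-⊕ (0ℤ , 0ℤ) (x , y)) (cong₂ _,_ (+-identityʳ x) (+-identityʳ y))
... | c02 c = κ₁ , λ { (inj₁ c′) → J⊆P (J¼-κ₁ c′) ; {x} (inj₂ c′) → Coset-02-fill cl J⊆P c pp (J¼⇒Coset _ x c′) }
... | c20 c = κ₂ , λ { (inj₁ c′) → J⊆P (J¼-κ₂ c′) ; {x} (inj₂ c′) → Coset-20-fill cl J⊆P c pp (J¼⇒Coset _ x c′) }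

-- J½ modulo 4

-- Arithmetic of the integers modulo 4, given by tables so that exhaustive checks over `Fin 4`
-- evaluate without division.
suc₄ pred₄ -₄_ : Fin 4 → Fin 4
suc₄ 0F = 1F
suc₄ 1F = 2F
suc₄ 2F = 3F
suc₄ 3F = 0F
pred₄ 0F = 3F
pred₄ 1F = 0F
pred₄ 2F = 1F
pred₄ 3F = 2F
-₄ 0F = 0F
-₄ 1F = 3F
-₄ 2F = 2F
-₄ 3F = 1F

_+₄_ _*₄_ : Fin 4 → Fin 4 → Fin 4
0F +₄ b = b
1F +₄ b = suc₄ b
2F +₄ b = suc₄ (suc₄ b)
3F +₄ b = pred₄ b
0F *₄ b = 0F
1F *₄ b = b
2F *₄ b = b +₄ b
3F *₄ b = -₄ b

residue₄ : ℤ → Fin 4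
residue₄ (+ zero)       = 0F
residue₄ (+ suc n)      = suc₄ (residue₄ (+ n))
residue₄ -[1+ zero ]    = 3F
residue₄ -[1+ suc n ]   = pred₄ (residue₄ -[1+ n ])

suc₄-pred₄ : ∀ a → suc₄ (pred₄ a) ≡ a
suc₄-pred₄ = toWitness {a? = Finₚ.all? λ a → suc₄ (pred₄ a) Finₚ.≟ a} _

pred₄-suc₄ : ∀ a → pred₄ (suc₄ a) ≡ a
pred₄-suc₄ = toWitness {a? = Finₚ.all? λ a → pred₄ (suc₄ a) Finₚ.≟ a} _

residue₄-suc : ∀ z → residue₄ (1ℤ + z) ≡ suc₄ (residue₄ z)
residue₄-suc (+ n)          = refl
residue₄-suc -[1+ zero ]    = refl
residue₄-suc -[1+ suc n ]   = sym (suc₄-pred₄ (residue₄ -[1+ n ]))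

residue₄-pred : ∀ z → residue₄ (-1ℤ + z) ≡ pred₄ (residue₄ z)
residue₄-pred (+ zero)   = refl
residue₄-pred (+ suc n)  = sym (pred₄-suc₄ (residue₄ (+ n)))
residue₄-pred -[1+ n ]   = refl

residue₄-+ : ∀ x y → residue₄ (x + y) ≡ residue₄ x +₄ residue₄ y
residue₄-+ x y = ℤ-induction (λ x → residue₄ (x + y) ≡ residue₄ x +₄ residue₄ y) (cong residue₄ (+-identityˡ y))
  (λ z ih → trans (cong residue₄ (+-assoc 1ℤ z y)) (trans (residue₄-suc (z + y))
    (trans (cong suc₄ ih) (trans (suc₄-+₄ (residue₄ z) (residue₄ y)) (cong (_+₄ residue₄ y) (sym (residue₄-suc z)))))))
  (λ z ih → trans (cong residue₄ (+-assoc -1ℤ z y)) (trans (residue₄-pred (z + y))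
    (trans (cong pred₄ ih) (trans (pred₄-+₄ (residue₄ z) (residue₄ y)) (cong (_+₄ residue₄ y) (sym (residue₄-pred z)))))))
  x
  where
  suc₄-+₄ : ∀ a b → suc₄ (a +₄ b) ≡ suc₄ a +₄ b
  suc₄-+₄ = toWitness {a? = Finₚ.all? λ a → Finₚ.all? λ b → suc₄ (a +₄ b) Finₚ.≟ suc₄ a +₄ b} _
  pred₄-+₄ : ∀ a b → pred₄ (a +₄ b) ≡ pred₄ a +₄ b
  pred₄-+₄ = toWitness {a? = Finₚ.all? λ a → Finₚ.all? λ b → pred₄ (a +₄ b) Finₚ.≟ pred₄ a +₄ b} _

-- Additive inverses modulo 4 are unique, so it is enough that the two residues add up to zero.
residue₄-neg : ∀ x → residue₄ (- x) ≡ -₄ residue₄ x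
residue₄-neg x = unique (residue₄ x) (residue₄ (- x)) (trans (sym (residue₄-+ x (- x))) (cong residue₄ (+-inverseʳ x)))
  where
  unique : ∀ a b → a +₄ b ≡ 0F → b ≡ -₄ a
  unique = toWitness {a? = Finₚ.all? λ a → Finₚ.all? λ b → ((a +₄ b) Finₚ.≟ 0F) →-dec (b Finₚ.≟ -₄ a)} _

residue₄-* : ∀ x y → residue₄ (x * y) ≡ residue₄ x *₄ residue₄ y
residue₄-* x y = ℤ-induction (λ x → residue₄ (x * y) ≡ residue₄ x *₄ residue₄ y) refl
  (λ z ih → trans (cong residue₄ (solve 2 (λ z y → (con 1ℤ :+ z) :* y := y :+ z :* y) refl z y))
    (trans (residue₄-+ y (z * y)) (trans (cong (residue₄ y +₄_) ih)
      (trans (suc₄-*₄ (residue₄ z) (residue₄ y)) (cong (_*₄ residue₄ y) (sym (residue₄-suc z)))))))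
  (λ z ih → trans (cong residue₄ (solve 2 (λ z y → (con -1ℤ :+ z) :* y := :- y :+ z :* y) refl z y))
    (trans (residue₄-+ (- y) (z * y)) (trans (cong₂ _+₄_ (residue₄-neg y) ih)
      (trans (pred₄-*₄ (residue₄ z) (residue₄ y)) (cong (_*₄ residue₄ y) (sym (residue₄-pred z)))))))
  x
  where
  suc₄-*₄ : ∀ a b → b +₄ (a *₄ b) ≡ suc₄ a *₄ b
  suc₄-*₄ = toWitness {a? = Finₚ.all? λ a → Finₚ.all? λ b → (b +₄ (a *₄ b)) Finₚ.≟ (suc₄ a *₄ b)} _
  pred₄-*₄ : ∀ a b → (-₄ b) +₄ (a *₄ b) ≡ pred₄ a *₄ b
  pred₄-*₄ = toWitness {a? = Finₚ.all? λ a → Finₚ.all? λ b → ((-₄ b) +₄ (a *₄ b)) Finₚ.≟ (pred₄ a *₄ b)} _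

_-₄_ : Fin 4 → Fin 4 → Fin 4
a -₄ b = a +₄ (-₄ b)

residue₄-minus : ∀ x y → residue₄ (x - y) ≡ residue₄ x -₄ residue₄ y
residue₄-minus x y = trans (residue₄-+ x (- y)) (cong (residue₄ x +₄_) (residue₄-neg y))

high : Fin 4 → Bool
high 0F = false
high 1F = false
high 2F = true
high 3F = true

-- J½ consists of the (x , y) with ⌊x/2⌋ + ⌊y/2⌋ even.
j¼ j½ : Fin 4 → Fin 4 → Bool
j¼ 0F 0F = true
j¼ 1F 0F = true
j¼ 0F 1F = true
j¼ 3F 3F = true
j¼ _  _  = false
j½ x y = not (high x xor high y)

J¼⇒j¼ : ∀ {p} → J¼ p → j¼ (residue₄ (proj₁ p)) (residue₄ (proj₂ p)) ≡ true
J¼⇒j¼ ((q₁ , q₂) , (x , y) , q∈Δ₀ , refl) =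
  trans (cong₂ j¼ (residue-of q₁ x) (residue-of q₂ y)) (table q∈Δ₀)
  where
  residue-of : ∀ q v → residue₄ (q + + 4 * v) ≡ residue₄ q +₄ 0F
  residue-of q v = trans (residue₄-+ q (+ 4 * v)) (cong (residue₄ q +₄_) (residue₄-* (+ 4) v))
  table : ∀ {q} → q ∈ Δ₀ → j¼ (residue₄ (proj₁ q) +₄ 0F) (residue₄ (proj₂ q) +₄ 0F) ≡ true
  table ∈₀ = refl
  table ∈₁ = refl
  table ∈₂ = refl
  table ∈₃ = refl

Coset⇒j¼ : ∀ {t p} → Coset t p →
           j¼ (residue₄ (proj₁ p) -₄ residue₄ (proj₁ t)) (residue₄ (proj₂ p) -₄ residue₄ (proj₂ t)) ≡ true
Coset⇒j¼ {t₁ , t₂} {x , y} c =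
  trans (sym (cong₂ j¼ (residue₄-minus x t₁) (residue₄-minus y t₂))) (J¼⇒j¼ (Coset⇒J¼ c))

J½⇒j½ : ∀ {p} → J½ p → j½ (residue₄ (proj₁ p)) (residue₄ (proj₂ p)) ≡ true
J½⇒j½ (inj₁ c) = table _ _ (J¼⇒j¼ c)
  where
  table : ∀ x y → j¼ x y ≡ true → j½ x y ≡ true
  table = toWitness {a? = Finₚ.all? λ x → Finₚ.all? λ y → (j¼ x y Bool.≟ true) →-dec (j½ x y Bool.≟ true)} _
J½⇒j½ {p} (inj₂ c) = table (residue₄ (proj₁ p)) (residue₄ (proj₂ p)) (Coset⇒j¼ (J¼⇒Coset (+ 2 , + 2) p c))
  where
  table : ∀ x y → j¼ (x -₄ 2F) (y -₄ 2F) ≡ true → j½ x y ≡ true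
  table = toWitness {a? = Finₚ.all? λ x → Finₚ.all? λ y →
    (j¼ (x -₄ 2F) (y -₄ 2F) Bool.≟ true) →-dec (j½ x y Bool.≟ true)} _

Coset-02⇒j½ : ∀ {p} → Coset (+ 0 , + 2) p → ¬ j½ (residue₄ (proj₁ p)) (residue₄ (proj₂ p)) ≡ true
Coset-02⇒j½ {p} c = table (residue₄ (proj₁ p)) (residue₄ (proj₂ p)) (Coset⇒j¼ c)
  where
  table : ∀ x y → j¼ (x -₄ 0F) (y -₄ 2F) ≡ true → ¬ j½ x y ≡ true
  table = toWitness {a? = Finₚ.all? λ x → Finₚ.all? λ y →
    (j¼ (x -₄ 0F) (y -₄ 2F) Bool.≟ true) →-dec ¬? (j½ x y Bool.≟ true)} _

Coset-20⇒j½ : ∀ {p} → Coset (+ 2 , + 0) p → ¬ j½ (residue₄ (proj₁ p)) (residue₄ (proj₂ p)) ≡ true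
Coset-20⇒j½ {p} c = table (residue₄ (proj₁ p)) (residue₄ (proj₂ p)) (Coset⇒j¼ c)
  where
  table : ∀ x y → j¼ (x -₄ 2F) (y -₄ 0F) ≡ true → ¬ j½ x y ≡ true
  table = toWitness {a? = Finₚ.all? λ x → Finₚ.all? λ y →
    (j¼ (x -₄ 2F) (y -₄ 0F) Bool.≟ true) →-dec ¬? (j½ x y Bool.≟ true)} _

-- The point lies in one of four cosets, and the tables exclude the two outside `J½`. With the
-- converse above, membership in `J½` becomes a condition on residues, ready for a finite check.
j½⇒J½ : ∀ p → j½ (residue₄ (proj₁ p)) (residue₄ (proj₂ p)) ≡ true → J½ p
j½⇒J½ p e with coset4 p
... | c00 c = inj₁ c
... | c22 c = inj₂ (Coset⇒J¼ c)
... | c02 c = ⊥-elim (Coset-02⇒j½ c e)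
... | c20 c = ⊥-elim (Coset-20⇒j½ c e)

Coset-20∉J½ : ∀ {p} → Coset (+ 2 , + 0) p → ¬ J½ p
Coset-20∉J½ c j = Coset-20⇒j½ c (J½⇒j½ j)

orient₄ : (d₁ d₂ a₁ a₂ b₁ b₂ : Fin 4) → Fin 4
orient₄ d₁ d₂ a₁ a₂ b₁ b₂ = ((a₁ -₄ d₁) *₄ (b₂ -₄ d₂)) -₄ ((b₁ -₄ d₁) *₄ (a₂ -₄ d₂))

third₄ : Fin 4 → Fin 4 → Fin 4 → Fin 4
third₄ d a b = ((3F *₄ d) -₄ a) -₄ b

-- An internal triangle contains an even number of points of J½; modulo 4 this is a finite check.
j½-even : ∀ d₁ d₂ a₁ a₂ b₁ b₂ →
  orient₄ d₁ d₂ a₁ a₂ b₁ b₂ *₄ orient₄ d₁ d₂ a₁ a₂ b₁ b₂ ≡ 1F → j½ a₁ a₂ ≡ true → j½ b₁ b₂ ≡ true →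
  j½ (third₄ d₁ a₁ b₁) (third₄ d₂ a₂ b₂) ≡ j½ d₁ d₂
j½-even = toWitness {a? = Finₚ.all? λ d₁ → Finₚ.all? λ d₂ → Finₚ.all? λ a₁ → Finₚ.all? λ a₂ →
  Finₚ.all? λ b₁ → Finₚ.all? λ b₂ →
  ((orient₄ d₁ d₂ a₁ a₂ b₁ b₂ *₄ orient₄ d₁ d₂ a₁ a₂ b₁ b₂) Finₚ.≟ 1F) →-dec
  ((j½ a₁ a₂ Bool.≟ true) →-dec ((j½ b₁ b₂ Bool.≟ true) →-dec
  (j½ (third₄ d₁ a₁ b₁) (third₄ d₂ a₂ b₂) Bool.≟ j½ d₁ d₂)))} _

-- `J½` contains all of `Δ₀` and is not free, so its stability cannot come from freeness. Once two
-- vertices are in `J½`, the remaining vertex and the centre have equal truth values, which gives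
-- both rules.
J½-IClosed : IClosed J½
J½-IClosed = record
  { centre = λ {_} {_} {c} {d} i ja jb jc → j½⇒J½ d (trans (sym (even i ja jb)) (J½⇒j½ jc))
  ; corner = λ {_} {_} {c} {d} i ja jb jd → j½⇒J½ c (trans (even i ja jb) (J½⇒j½ jd)) }
  where
  even : ∀ {a b c d} → Internal a b c d → J½ a → J½ b →
         j½ (residue₄ (proj₁ c)) (residue₄ (proj₂ c)) ≡ j½ (residue₄ (proj₁ d)) (residue₄ (proj₂ d))
  even {a₁ , a₂} {b₁ , b₂} {_} {d₁ , d₂} (internal (unit u) refl) ja jb =
    trans (cong₂ j½ (residue₄-third d₁ a₁ b₁) (residue₄-third d₂ a₂ b₂))
      (j½-even (residue₄ d₁) (residue₄ d₂) (residue₄ a₁) (residue₄ a₂) (residue₄ b₁) (residue₄ b₂)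
        (trans (sym (cong₂ _*₄_ residue₄-orient residue₄-orient)) (trans (sym (residue₄-* o o)) (cong residue₄ u)))
        (J½⇒j½ ja) (J½⇒j½ jb))
    where
    o : ℤ
    o = orient (d₁ , d₂) (a₁ , a₂) (b₁ , b₂)
    residue₄-third : ∀ d a b → residue₄ ((+ 3 * d - a) - b) ≡ third₄ (residue₄ d) (residue₄ a) (residue₄ b)
    residue₄-third d a b = trans (residue₄-minus (+ 3 * d - a) b) (cong (_-₄ residue₄ b)
      (trans (residue₄-minus (+ 3 * d) a) (cong (_-₄ residue₄ a) (residue₄-* (+ 3) d))))
    residue₄-product : ∀ a d b e → residue₄ ((a - d) * (b - e)) ≡ (residue₄ a -₄ residue₄ d) *₄ (residue₄ b -₄ residue₄ e)
    residue₄-product a d b e = trans (residue₄-* (a - d) (b - e)) (cong₂ _*₄_ (residue₄-minus a d) (residue₄-minus b e))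
    residue₄-orient : residue₄ o ≡ orient₄ (residue₄ d₁) (residue₄ d₂) (residue₄ a₁) (residue₄ a₂) (residue₄ b₁) (residue₄ b₂)
    residue₄-orient = trans (residue₄-minus ((a₁ - d₁) * (b₂ - d₂)) ((b₁ - d₁) * (a₂ - d₂)))
      (cong₂ _-₄_ (residue₄-product a₁ d₁ b₂ d₂) (residue₄-product b₁ d₁ a₂ d₂))

-- Classification of minimal triangles

0≤⇒ℕ : ∀ {z} → 0ℤ ≤ z → ∃[ n ] z ≡ + n
0≤⇒ℕ {+ n} _ = n , refl

0≤-+ : ∀ {x y} → 0ℤ ≤ x → 0ℤ ≤ y → 0ℤ ≤ x + y
0≤-+ {+ _} {+ _} _ _ = +≤+ z≤n

0≤-* : ∀ {x y} → 0ℤ ≤ x → 0ℤ ≤ y → 0ℤ ≤ x * y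
0≤-* {+ m} {+ n} _ _ = subst (0ℤ ≤_) (ℤₚ.pos-* m n) (+≤+ z≤n)

0≤-cancel : ∀ x {y} → 0ℤ < x → 0ℤ ≤ x * y → 0ℤ ≤ y
0≤-cancel (+ suc _) {+ _} _ _ = +≤+ z≤n
0≤-cancel (+ zero) (+<+ ())

0<-* : ∀ {x y} → 0ℤ < x → 0ℤ < y → 0ℤ < x * y
0<-* {+ suc _} {+ suc _} _ _ = +<+ (s≤s z≤n)
0<-* {+ zero} (+<+ ())
0<-* {_} {+ zero} _ (+<+ ())

*-cancel-0 : ∀ x {y} → 0ℤ < x → x * y ≡ 0ℤ → y ≡ 0ℤ
*-cancel-0 x 0<x e with ℤₚ.i*j≡0⇒i≡0∨j≡0 x e
... | inj₁ refl = ⊥-elim (ℤₚ.<-irrefl refl 0<x)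
... | inj₂ y≡0 = y≡0

0≤-antisym : ∀ {x} → 0ℤ ≤ x → 0ℤ ≤ - x → x ≡ 0ℤ
0≤-antisym {+ zero} _ _ = refl
0≤-antisym {+ suc _} _ ()

module _ (U : Unimodular) where

  orient-*-U : ∀ a b c p q r → orient (applyU U a) (applyU U b) (applyU U c) * orient (applyU U p) (applyU U q) (applyU U r)
                               ≡ orient a b c * orient p q r
  orient-*-U a b c p q r =
    trans (cong₂ _*_ (orient-U U a b c) (orient-U U p q r))
    (trans (solve 3 (λ δ x y → (δ :* x) :* (δ :* y) := (δ :* δ) :* (x :* y)) refl (det U) (orient a b c) (orient p q r))
    (trans (cong (_* (orient a b c * orient p q r)) (Unit.square (det-unit U))) (*-identityˡ _)))

  InTri-U : ∀ {a b c p} → InTri a b c p → InTri (applyU U a) (applyU U b) (applyU U c) (applyU U p)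
  InTri-U {a} {b} {c} {p} (x , y , z) =
    subst (0ℤ ≤_) (sym (orient-*-U a b c a b p)) x ,
    subst (0ℤ ≤_) (sym (orient-*-U a b c b c p)) y ,
    subst (0ℤ ≤_) (sym (orient-*-U a b c c a p)) z

  InTri-U⁻¹ : ∀ {a b c p} → InTri (applyU U a) (applyU U b) (applyU U c) (applyU U p) → InTri a b c p
  InTri-U⁻¹ {a} {b} {c} {p} (x , y , z) =
    subst (0ℤ ≤_) (orient-*-U a b c a b p) x ,
    subst (0ℤ ≤_) (orient-*-U a b c b c p) y ,
    subst (0ℤ ≤_) (orient-*-U a b c c a p) z

  InInterior-U : ∀ {a b c p} → InInterior a b c p → InInterior (applyU U a) (applyU U b) (applyU U c) (applyU U p)
  InInterior-U {a} {b} {c} {p} (x , y , z) =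
    subst (0ℤ <_) (sym (orient-*-U a b c a b p)) x ,
    subst (0ℤ <_) (sym (orient-*-U a b c b c p)) y ,
    subst (0ℤ <_) (sym (orient-*-U a b c c a p)) z

  InInterior-U⁻¹ : ∀ {a b c p} → InInterior (applyU U a) (applyU U b) (applyU U c) (applyU U p) → InInterior a b c p
  InInterior-U⁻¹ {a} {b} {c} {p} (x , y , z) =
    subst (0ℤ <_) (orient-*-U a b c a b p) x ,
    subst (0ℤ <_) (orient-*-U a b c b c p) y ,
    subst (0ℤ <_) (orient-*-U a b c c a p) z

  applyU-injective : ∀ {p q} → applyU U p ≡ applyU U q → p ≡ q
  applyU-injective {p} {q} e =
    trans (sym (applyU-inverseˡ U p)) (trans (cong (applyU (inverse U)) e) (applyU-inverseˡ U q))

  IsMinimal-U : ∀ {a b c d} → IsMinimal a b c d → IsMinimal (applyU U a) (applyU U b) (applyU U c) (applyU U d)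
  IsMinimal-U {a} {b} {c} {d} (nc , inT , d≢a , d≢b , d≢c , only) =
    (λ e → nc (unit-cancel (trans (sym (orient-U U a b c)) e))) ,
    InTri-U {a} {b} {c} {d} inT ,
    d≢a ∘ applyU-injective , d≢b ∘ applyU-injective , d≢c ∘ applyU-injective ,
    λ p inp → move p (only (applyU (inverse U) p) (InTri-U⁻¹ {a} {b} {c} {applyU (inverse U) p}
      (subst (InTri (applyU U a) (applyU U b) (applyU U c)) (sym (applyU-inverseʳ U p)) inp)))
    where
    unit-cancel : ∀ {x} → det U * x ≡ 0ℤ → x ≡ 0ℤ
    unit-cancel {x} e = trans (sym (*-identityˡ x)) (trans (cong (_* x) (sym (Unit.square (det-unit U))))
      (trans (ℤₚ.*-assoc (det U) (det U) x) (trans (cong (det U *_) e) (ℤₚ.*-zeroʳ (det U)))))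
    to : ∀ {p x} → applyU (inverse U) p ≡ x → p ≡ applyU U x
    to {p} e = trans (sym (applyU-inverseʳ U p)) (cong (applyU U) e)
    move : ∀ p → (applyU (inverse U) p ≡ a) ⊎ (applyU (inverse U) p ≡ b) ⊎ (applyU (inverse U) p ≡ c) ⊎ (applyU (inverse U) p ≡ d) →
      (p ≡ applyU U a) ⊎ (p ≡ applyU U b) ⊎ (p ≡ applyU U c) ⊎ (p ≡ applyU U d)
    move p (inj₁ e) = inj₁ (to e)
    move p (inj₂ (inj₁ e)) = inj₂ (inj₁ (to e))
    move p (inj₂ (inj₂ (inj₁ e))) = inj₂ (inj₂ (inj₁ (to e)))
    move p (inj₂ (inj₂ (inj₂ e))) = inj₂ (inj₂ (inj₂ (to e)))

-- Up to scale, `y`, `(x + 1) - y` and `(1 - x) - y` are the barycentric coordinates. They are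
-- natural numbers `m`, `α`, `β` with `2 m + α + β = 2`, which has four solutions: the three
-- vertices and the midpoint.
border₀ : IsBorder (1ℤ , 0ℤ) (-1ℤ , 0ℤ) (0ℤ , 1ℤ) (0ℤ , 0ℤ)
border₀ = ((λ ()) , inT , (λ ()) , (λ ()) , (λ ()) , λ { (x , y) inp → only x y inp }) ,
          inT , λ { (+<+ () , _) }
  where
  inT : InTri (1ℤ , 0ℤ) (-1ℤ , 0ℤ) (0ℤ , 1ℤ) (0ℤ , 0ℤ)
  inT = +≤+ z≤n , +≤+ z≤n , +≤+ z≤n

  sum-2 : ∀ x y α → α ≡ (x + 1ℤ) - y → x ≡ (α - 1ℤ) + y
  sum-2 x y _ refl = solve 2 (λ x y → x := (((x :+ con 1ℤ) :- y) :- con 1ℤ) :+ y) refl x y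

  ℕ-sum : ∀ x y (α β m : ℕ) → y ≡ + m → (x + 1ℤ) - y ≡ + α → (1ℤ - x) - y ≡ + β → m ℕ.* 2 ℕ.+ α ℕ.+ β ≡ 2
  ℕ-sum x y α β m ym xα xβ = +-injective (trans (cong (λ s → s + + α + + β) (ℤₚ.pos-* m 2))
    (trans (cong₂ _+_ (cong₂ (λ s t → s * + 2 + t) (sym ym) (sym xα)) (sym xβ))
      (solve 2 (λ x y → (y :* con (+ 2) :+ ((x :+ con 1ℤ) :- y)) :+ ((con 1ℤ :- x) :- y) := con (+ 2)) refl x y)))

  conclude : ∀ x y α β m → y ≡ + m → x ≡ (+ α - 1ℤ) + y → m ℕ.* 2 ℕ.+ α ℕ.+ β ≡ 2 →
    ((x , y) ≡ (1ℤ , 0ℤ)) ⊎ ((x , y) ≡ (-1ℤ , 0ℤ)) ⊎ ((x , y) ≡ (0ℤ , 1ℤ)) ⊎ ((x , y) ≡ (0ℤ , 0ℤ))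
  conclude _ _ 0 β 0 refl refl s = inj₂ (inj₁ refl)
  conclude _ _ 1 β 0 refl refl s = inj₂ (inj₂ (inj₂ refl))
  conclude _ _ 2 β 0 refl refl s = inj₁ refl
  conclude _ _ 0 β 1 refl refl s = inj₂ (inj₂ (inj₁ refl))
  conclude _ _ (suc (suc (suc α))) β 0 refl refl ()
  conclude _ _ (suc α) β 1 refl refl ()
  conclude _ _ α β (suc (suc m)) refl refl ()

  only : ∀ x y → InTri (1ℤ , 0ℤ) (-1ℤ , 0ℤ) (0ℤ , 1ℤ) (x , y) →
    ((x , y) ≡ (1ℤ , 0ℤ)) ⊎ ((x , y) ≡ (-1ℤ , 0ℤ)) ⊎ ((x , y) ≡ (0ℤ , 1ℤ)) ⊎ ((x , y) ≡ (0ℤ , 0ℤ))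
  only x y (p , q , r)
    with 0≤⇒ℕ (0≤-cancel (+ 4) (+<+ (s≤s z≤n)) (subst (0ℤ ≤_) (solve 2 (λ x y →
           con -[1+ 1 ] :* (con -[1+ 1 ] :* (y :- con 0ℤ) :- (x :- con 1ℤ) :* con 0ℤ) := con (+ 4) :* y) refl x y) p))
       | 0≤⇒ℕ (0≤-cancel (+ 2) (+<+ (s≤s z≤n)) (subst (0ℤ ≤_) (solve 2 (λ x y →
           con -[1+ 1 ] :* (con 1ℤ :* (y :- con 0ℤ) :- (x :- con -1ℤ) :* con 1ℤ) := con (+ 2) :* ((x :+ con 1ℤ) :- y)) refl x y) q))
       | 0≤⇒ℕ (0≤-cancel (+ 2) (+<+ (s≤s z≤n)) (subst (0ℤ ≤_) (solve 2 (λ x y →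
           con -[1+ 1 ] :* (con 1ℤ :* (y :- con 1ℤ) :- (x :- con 0ℤ) :* con -1ℤ) := con (+ 2) :* ((con 1ℤ :- x) :- y)) refl x y) r))
  ... | m , ym | α , xα | β , xβ = conclude x y α β m ym (sum-2 x y (+ α) (sym xα)) (ℕ-sum x y α β m ym xα xβ)

internal₀ : IsInternal (1ℤ , 0ℤ) (0ℤ , 1ℤ) (-1ℤ , -1ℤ) (0ℤ , 0ℤ)
internal₀ = ((λ ()) , inT , (λ ()) , (λ ()) , (λ ()) , λ { (x , y) inp → only x y inp }) ,
            +<+ (s≤s z≤n) , +<+ (s≤s z≤n) , +<+ (s≤s z≤n)
  where
  inT : InTri (1ℤ , 0ℤ) (0ℤ , 1ℤ) (-1ℤ , -1ℤ) (0ℤ , 0ℤ)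
  inT = +≤+ z≤n , +≤+ z≤n , +≤+ z≤n

  Vertex : ℤ → ℤ → Set
  Vertex x y = ((x , y) ≡ (1ℤ , 0ℤ)) ⊎ ((x , y) ≡ (0ℤ , 1ℤ)) ⊎ ((x , y) ≡ (-1ℤ , -1ℤ)) ⊎ ((x , y) ≡ (0ℤ , 0ℤ))

  not-divisible : ∀ x {z k} → x * + 3 ≡ z → ∣ z ∣ ≡ suc k → k ℕ.< 2 → ⊥
  not-divisible x {z} {k} e f = absurd ∣ x ∣ (trans (sym (abs-* x (+ 3))) (trans (cong ∣_∣ e) f))
    where
    absurd : ∀ n → n ℕ.* 3 ≡ suc k → ¬ k ℕ.< 2
    absurd (suc n) refl (s≤s (s≤s ()))

  x≡ : ∀ x k → x * + 3 ≡ k * + 3 → x ≡ k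
  x≡ x k = ℤₚ.*-cancelʳ-≡ x k (+ 3)

  -- The barycentric coordinates l, m, n have sum 3, and m - l = 3 x.
  conclude : ∀ x y l m n → x * + 3 ≡ + m - + l → y ≡ (1ℤ - x) - + l → l ℕ.+ m ℕ.+ n ≡ 3 → Vertex x y
  conclude x _ 0 0 n e refl s with refl ← x≡ x 0ℤ e = inj₂ (inj₁ refl)
  conclude x _ 0 3 n e refl s with refl ← x≡ x 1ℤ e = inj₁ refl
  conclude x _ 3 0 n e refl s with refl ← x≡ x -1ℤ e = inj₂ (inj₂ (inj₁ refl))
  conclude x _ 1 1 n e refl s with refl ← x≡ x 0ℤ e = inj₂ (inj₂ (inj₂ refl))
  -- In this and the next five cases `m - l` has absolute value 1 or 2 and cannot be `3 x`.
  conclude x _ 0 1 n e f s = ⊥-elim (not-divisible x e refl (s≤s z≤n))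
  conclude x _ 0 2 n e f s = ⊥-elim (not-divisible x e refl (s≤s (s≤s z≤n)))
  conclude x _ 1 0 n e f s = ⊥-elim (not-divisible x e refl (s≤s z≤n))
  conclude x _ 1 2 n e f s = ⊥-elim (not-divisible x e refl (s≤s z≤n))
  conclude x _ 2 0 n e f s = ⊥-elim (not-divisible x e refl (s≤s (s≤s z≤n)))
  conclude x _ 2 1 n e f s = ⊥-elim (not-divisible x e refl (s≤s z≤n))
  conclude _ _ 0 (suc (suc (suc (suc _)))) _ _ _ ()
  conclude _ _ 1 (suc (suc (suc _))) _ _ _ ()
  conclude _ _ 2 (suc (suc _)) _ _ _ ()
  conclude _ _ 3 (suc _) _ _ _ ()
  conclude _ _ (suc (suc (suc (suc _)))) _ _ _ _ ()

  only : ∀ x y → InTri (1ℤ , 0ℤ) (0ℤ , 1ℤ) (-1ℤ , -1ℤ) (x , y) → Vertex x y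
  only x y (p , q , r)
    with 0≤⇒ℕ (0≤-cancel (+ 3) (+<+ (s≤s z≤n)) (subst (0ℤ ≤_) (solve 2 (λ x y →
           con (+ 3) :* (con -1ℤ :* (y :- con 0ℤ) :- (x :- con 1ℤ) :* con 1ℤ) := con (+ 3) :* ((con 1ℤ :- x) :- y)) refl x y) p))
       | 0≤⇒ℕ (0≤-cancel (+ 3) (+<+ (s≤s z≤n)) (subst (0ℤ ≤_) (solve 2 (λ x y →
           con (+ 3) :* (con -1ℤ :* (y :- con 1ℤ) :- (x :- con 0ℤ) :* con -[1+ 1 ])
           := con (+ 3) :* ((con (+ 2) :* x :- y) :+ con 1ℤ)) refl x y) q))
       | 0≤⇒ℕ (0≤-cancel (+ 3) (+<+ (s≤s z≤n)) (subst (0ℤ ≤_) (solve 2 (λ x y →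
           con (+ 3) :* (con (+ 2) :* (y :- con -1ℤ) :- (x :- con -1ℤ) :* con 1ℤ)
           := con (+ 3) :* ((con (+ 2) :* y :- x) :+ con 1ℤ)) refl x y) r))
  ... | l , xl | m , xm | n , xn = conclude x y l m n
    (trans (solve 2 (λ x y → x :* con (+ 3) := ((con (+ 2) :* x :- y) :+ con 1ℤ) :- ((con 1ℤ :- x) :- y)) refl x y)
           (cong₂ _-_ xm xl))
    (trans (solve 2 (λ x y → y := (con 1ℤ :- x) :- ((con 1ℤ :- x) :- y)) refl x y) (cong (λ l → (1ℤ - x) - l) xl))
    (+-injective (trans (cong₂ _+_ (cong₂ _+_ (sym xl) (sym xm)) (sym xn))
      (solve 2 (λ x y → (((con 1ℤ :- x) :- y) :+ ((con (+ 2) :* x :- y) :+ con 1ℤ)) :+ ((con (+ 2) :* y :- x) :+ con 1ℤ)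
                        := con (+ 3)) refl x y)))

Internal⇒IsInternal : ∀ {a b c d} → Internal a b c d → IsInternal a b c d
Internal⇒IsInternal {a} {b} {_} {d} (internal u refl) =
  subst₂ (λ c d → IsInternal a b c d) (frame-third d a b u) (frame-00 d a b u)
  (subst₂ (λ a b → IsInternal a b (F (-1ℤ , -1ℤ)) (F (0ℤ , 0ℤ))) (frame-10 d a b u) (frame-01 d a b u)
    (IsMinimal-U U (proj₁ internal₀) ,
     InInterior-U U {1ℤ , 0ℤ} {0ℤ , 1ℤ} { -1ℤ , -1ℤ} {0ℤ , 0ℤ} (proj₂ internal₀)))
  where
  U : Unimodular
  U = frame d a b u
  F : Point → Point
  F = applyU U

Border⇒IsBorder : ∀ {a b c d} → Border a b c d → IsBorder a b c d
Border⇒IsBorder {a} {_} {c} {d} (border u refl) =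
  subst₂ (λ b d → IsBorder a b c d) (frame-opposite d a c u′) (frame-00 d a c u′)
  (subst₂ (λ a c → IsBorder a (F (-1ℤ , 0ℤ)) c (F (0ℤ , 0ℤ))) (frame-10 d a c u′) (frame-01 d a c u′)
    (IsMinimal-U U (proj₁ border₀) ,
     InTri-U U {1ℤ , 0ℤ} { -1ℤ , 0ℤ} {0ℤ , 1ℤ} {0ℤ , 0ℤ} (proj₁ (proj₂ border₀)) ,
     proj₂ (proj₂ border₀) ∘ InInterior-U⁻¹ U {1ℤ , 0ℤ} { -1ℤ , 0ℤ} {0ℤ , 1ℤ} {0ℤ , 0ℤ}))
  where
  u′ : Unit (orient d a c)
  u′ = subst Unit (sym (orient-swap d c a)) (Unit-neg u)
  U : Unimodular
  U = frame d a c u′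
  F : Point → Point
  F = applyU U

det2-self : ∀ u → det2 u u ≡ 0ℤ
det2-self (u₁ , u₂) = solve 2 (λ u₁ u₂ → u₁ :* u₂ :- u₁ :* u₂ := con 0ℤ) refl u₁ u₂

square-divides⇒≡1 : ∀ n k → + suc n ≡ + suc n * (+ suc n * k) → suc n ≡ 1
square-divides⇒≡1 n k e = m*n≡1⇒m≡1 (suc n) ∣ k ∣ (trans (sym (abs-* (+ suc n) k)) (cong ∣_∣ one))
  where
  one : + suc n * k ≡ 1ℤ
  one = sym (ℤₚ.*-cancelˡ-≡ (+ suc n) 1ℤ (+ suc n * k) (trans (ℤₚ.*-identityʳ (+ suc n)) e))

-- If D = det (u, v) > 1, reducing (1,0) or (0,1) modulo the lattice spanned by u and v gives a
-- lattice point (i u + j v)/D with 0 ≤ i, j < D not both zero; it or its mirror image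
-- u + v − (i u + j v)/D lies in the triangle 0, u, v.
module EmptyTriangle (u v : Point) (n : ℕ) (D≡ : det2 u v ≡ + suc n)
  (empty : ∀ r → 0ℤ ≤ det2 r v → 0ℤ ≤ det2 u r → 0ℤ ≤ (det2 u v - det2 r v) - det2 u r →
           r ≡ (0ℤ , 0ℤ) ⊎ r ≡ u ⊎ r ≡ v)
  where
  private
    D : ℕ
    D = suc n

    u₁ u₂ v₁ v₂ : ℤ
    u₁ = proj₁ u
    u₂ = proj₂ u
    v₁ = proj₁ v
    v₂ = proj₂ v

  module Reduce (r : Point) (s′ t′ : ℤ) (i j : ℕ)
    (s≡ : det2 r v ≡ + i + s′ * + D) (t≡ : det2 u r ≡ + j + t′ * + D) (i<D : i ℕ.< D) (j<D : j ℕ.< D) where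
    r₁ r₂ : ℤ
    r₁ = proj₁ r
    r₂ = proj₂ r

    q : Point
    q = (r ⊖ (s′ · u)) ⊖ (t′ · v)

    sub-quotient : ∀ {z} k z′ → z ≡ k + z′ * + D → z - z′ * + D ≡ k
    sub-quotient k z′ refl = solve 2 (λ a b → (a :+ b) :- b := a) refl k (z′ * + D)

    q-v : det2 q v ≡ + i
    q-v = trans (solve 8 (λ u₁ u₂ v₁ v₂ r₁ r₂ s t →
              ((r₁ :- s :* u₁) :- t :* v₁) :* v₂ :- v₁ :* ((r₂ :- s :* u₂) :- t :* v₂)
              := (r₁ :* v₂ :- v₁ :* r₂) :- s :* (u₁ :* v₂ :- v₁ :* u₂)) refl u₁ u₂ v₁ v₂ r₁ r₂ s′ t′)
          (trans (cong (λ d → det2 r v - s′ * d) D≡) (sub-quotient (+ i) s′ s≡))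

    u-q : det2 u q ≡ + j
    u-q = trans (solve 8 (λ u₁ u₂ v₁ v₂ r₁ r₂ s t →
              u₁ :* ((r₂ :- s :* u₂) :- t :* v₂) :- ((r₁ :- s :* u₁) :- t :* v₁) :* u₂
              := (u₁ :* r₂ :- r₁ :* u₂) :- t :* (u₁ :* v₂ :- v₁ :* u₂)) refl u₁ u₂ v₁ v₂ r₁ r₂ s′ t′)
          (trans (cong (λ d → det2 u r - t′ * d) D≡) (sub-quotient (+ j) t′ t≡))

    full : ∀ {k} → k ℕ.< D → det2 u v ≡ + k → ⊥
    full k<D e = ℕₚ.<⇒≢ k<D (sym (+-injective (trans (sym D≡) e)))

    mirror : Point
    mirror = (u ⊕ v) ⊖ q

    mirror-v : det2 mirror v ≡ + D - + i
    mirror-v = trans (solve 6 (λ u₁ u₂ v₁ v₂ q₁ q₂ →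
        ((u₁ :+ v₁) :- q₁) :* v₂ :- v₁ :* ((u₂ :+ v₂) :- q₂) := (u₁ :* v₂ :- v₁ :* u₂) :- (q₁ :* v₂ :- v₁ :* q₂))
        refl u₁ u₂ v₁ v₂ (proj₁ q) (proj₂ q)) (cong₂ _-_ D≡ q-v)

    u-mirror : det2 u mirror ≡ + D - + j
    u-mirror = trans (solve 6 (λ u₁ u₂ v₁ v₂ q₁ q₂ →
        u₁ :* ((u₂ :+ v₂) :- q₂) :- ((u₁ :+ v₁) :- q₁) :* u₂ := (u₁ :* v₂ :- v₁ :* u₂) :- (u₁ :* q₂ :- q₁ :* u₂))
        refl u₁ u₂ v₁ v₂ (proj₁ q) (proj₂ q)) (cong₂ _-_ D≡ u-q)

    0≢D-k : ∀ {k} → k ℕ.< D → 0ℤ ≡ + D - + k → ⊥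
    0≢D-k {k} k<D e = ℕₚ.<⇒≢ k<D (sym (+-injective (ℤₚ.i-j≡0⇒i≡j (+ D) (+ k) (sym e))))

    0≤D-k : ∀ {k} → k ℕ.< D → 0ℤ ≤ + D - + k
    0≤D-k k<D = ℤₚ.i≤j⇒0≤j-i (+≤+ (ℕₚ.<⇒≤ k<D))

    zeroˡ : ∀ x y → 0ℤ * y - x * 0ℤ ≡ 0ℤ
    zeroˡ = solve 2 (λ x y → con 0ℤ :* y :- x :* con 0ℤ := con 0ℤ) refl

    zeroʳ : ∀ x y → x * 0ℤ - 0ℤ * y ≡ 0ℤ
    zeroʳ = solve 2 (λ x y → x :* con 0ℤ :- con 0ℤ :* y := con 0ℤ) refl

    q-vertex : q ≡ (0ℤ , 0ℤ) ⊎ q ≡ u ⊎ q ≡ v → i ≡ 0 × j ≡ 0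
    q-vertex (inj₁ e) = +-injective (trans (sym q-v) (trans (cong (λ q → det2 q v) e) (zeroˡ v₁ v₂))) ,
                        +-injective (trans (sym u-q) (trans (cong (det2 u) e) (zeroʳ u₁ u₂)))
    q-vertex (inj₂ (inj₁ e)) = ⊥-elim (full i<D (trans (cong (λ q → det2 q v) (sym e)) q-v))
    q-vertex (inj₂ (inj₂ e)) = ⊥-elim (full j<D (trans (cong (det2 u) (sym e)) u-q))

    mirror-vertex : mirror ≡ (0ℤ , 0ℤ) ⊎ mirror ≡ u ⊎ mirror ≡ v → ⊥
    mirror-vertex (inj₁ e) = 0≢D-k i<D (trans (sym (zeroˡ v₁ v₂)) (trans (cong (λ q → det2 q v) (sym e)) mirror-v))
    mirror-vertex (inj₂ (inj₁ e)) = 0≢D-k j<D (trans (sym (det2-self u)) (trans (cong (det2 u) (sym e)) u-mirror))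
    mirror-vertex (inj₂ (inj₂ e)) = 0≢D-k i<D (trans (sym (det2-self v)) (trans (cong (λ q → det2 q v) (sym e)) mirror-v))

    i,j≡0 : i ≡ 0 × j ≡ 0
    i,j≡0 with ℕₚ.≤-total (i ℕ.+ j) D
    ... | inj₁ i+j≤D = q-vertex (empty q (subst (0ℤ ≤_) (sym q-v) (+≤+ z≤n)) (subst (0ℤ ≤_) (sym u-q) (+≤+ z≤n))
      (subst (0ℤ ≤_) (sym (trans (cong₂ _-_ (cong₂ _-_ D≡ q-v) u-q)
        (solve 3 (λ d i j → (d :- i) :- j := d :- (i :+ j)) refl (+ D) (+ i) (+ j))))
        (ℤₚ.i≤j⇒0≤j-i (+≤+ i+j≤D))))
    ... | inj₂ D≤i+j = ⊥-elim (mirror-vertex (empty mirror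
      (subst (0ℤ ≤_) (sym mirror-v) (0≤D-k i<D)) (subst (0ℤ ≤_) (sym u-mirror) (0≤D-k j<D))
      (subst (0ℤ ≤_) (sym (trans (cong₂ _-_ (cong₂ _-_ D≡ mirror-v) u-mirror)
        (solve 3 (λ d i j → (d :- (d :- i)) :- (d :- j) := (i :+ j) :- d) refl (+ D) (+ i) (+ j))))
        (ℤₚ.i≤j⇒0≤j-i (+≤+ D≤i+j)))))

  divides : ∀ r → ∃[ s ] ∃[ t ] (det2 r v ≡ s * + D × det2 u r ≡ t * + D)
  divides r = s /ℕ D , t /ℕ D , exact s (proj₁ zero-remainders) , exact t (proj₂ zero-remainders)
    where
    s t : ℤ
    s = det2 r v
    t = det2 u r
    zero-remainders : s %ℕ D ≡ 0 × t %ℕ D ≡ 0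
    zero-remainders = Reduce.i,j≡0 r (s /ℕ D) (t /ℕ D) (s %ℕ D) (t %ℕ D)
      (a≡a%ℕn+[a/ℕn]*n s D) (a≡a%ℕn+[a/ℕn]*n t D) (n%ℕd<d s D) (n%ℕd<d t D)
    exact : ∀ z → z %ℕ D ≡ 0 → z ≡ (z /ℕ D) * + D
    exact z e = trans (a≡a%ℕn+[a/ℕn]*n z D) (trans (cong (λ k → + k + (z /ℕ D) * + D) e) (+-identityˡ _))

  -- Applied to the two unit vectors, `divides` shows that `D` divides every entry of the matrix of
  -- `u` and `v`. Hence `D` squared divides the determinant `D`, which forces `D = 1`.
  unimodular : det2 u v ≡ 1ℤ
  unimodular = combine (divides (1ℤ , 0ℤ)) (divides (0ℤ , 1ℤ))
    where
    neg : ∀ {x} y → - x ≡ y * + D → x ≡ - y * + D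
    neg {x} y e = trans (solve 1 (λ x → x := :- (:- x)) refl x)
      (trans (cong -_ e) (solve 2 (λ y D → :- (y :* D) := (:- y) :* D) refl y (+ D)))
    combine : (∃[ s ] ∃[ t ] (det2 (1ℤ , 0ℤ) v ≡ s * + D × det2 u (1ℤ , 0ℤ) ≡ t * + D)) →
              (∃[ s ] ∃[ t ] (det2 (0ℤ , 1ℤ) v ≡ s * + D × det2 u (0ℤ , 1ℤ) ≡ t * + D)) → det2 u v ≡ 1ℤ
    combine (s₁ , t₁ , s₁≡ , t₁≡) (s₂ , t₂ , s₂≡ , t₂≡) =
      trans D≡ (cong +_ (square-divides⇒≡1 n (t₂ * s₁ - (- s₂) * (- t₁))
        (trans (sym D≡) (trans (cong₂ _-_ (cong₂ _*_ u₁≡ v₂≡) (cong₂ _*_ v₁≡ u₂≡))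
          (solve 5 (λ a b c d D → (a :* D) :* (b :* D) :- (c :* D) :* (d :* D) := D :* (D :* (a :* b :- c :* d)))
            refl t₂ s₁ (- s₂) (- t₁) (+ D))))))
      where
      u₁≡ : u₁ ≡ t₂ * + D
      u₁≡ = trans (solve 2 (λ x y → x := x :* con 1ℤ :- con 0ℤ :* y) refl u₁ u₂) t₂≡
      u₂≡ : u₂ ≡ - t₁ * + D
      u₂≡ = neg t₁ (trans (solve 2 (λ x y → :- y := x :* con 0ℤ :- con 1ℤ :* y) refl u₁ u₂) t₁≡)
      v₁≡ : v₁ ≡ - s₂ * + D
      v₁≡ = neg s₂ (trans (solve 2 (λ x y → :- x := con 0ℤ :* y :- x :* con 1ℤ) refl v₁ v₂) s₂≡)
      v₂≡ : v₂ ≡ s₁ * + D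
      v₂≡ = trans (solve 2 (λ x y → y := con 1ℤ :* y :- x :* con 0ℤ) refl v₁ v₂) s₁≡

InTri-rotate : ∀ {a b c p} → InTri a b c p → InTri b c a p
InTri-rotate {a} {b} {c} {p} (x , y , z) = rot y , rot z , rot x
  where
  rot : ∀ {w} → 0ℤ ≤ orient a b c * w → 0ℤ ≤ orient b c a * w
  rot {w} = subst (λ o → 0ℤ ≤ o * w) (sym (orient-rotate a b c))

InInterior-rotate : ∀ {a b c p} → InInterior a b c p → InInterior b c a p
InInterior-rotate {a} {b} {c} {p} (x , y , z) = rot y , rot z , rot x
  where
  rot : ∀ {w} → 0ℤ < orient a b c * w → 0ℤ < orient b c a * w
  rot {w} = subst (λ o → 0ℤ < o * w) (sym (orient-rotate a b c))

orient-flip : ∀ a b c → orient b a c ≡ - orient a b c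
orient-flip a b c = trans (orient-rotate c b a) (trans (orient-swap c a b) (cong -_ (sym (orient-rotate c a b))))

InTri-swap : ∀ {a b c p} → InTri a b c p → InTri b a c p
InTri-swap {a} {b} {c} {p} (x , y , z) =
  swap (orient-flip a b p) x , swap (orient-flip c a p) z , swap (orient-flip b c p) y
  where
  swap : ∀ {w w′} → w′ ≡ - w → 0ℤ ≤ orient a b c * w → 0ℤ ≤ orient b a c * w′
  swap {w} refl = subst (0ℤ ≤_) (trans (solve 2 (λ o w → o :* w := (:- o) :* (:- w)) refl (orient a b c) w)
                                       (cong (_* - w) (sym (orient-flip a b c))))

IsMinimal-rotate : ∀ {a b c d} → IsMinimal a b c d → IsMinimal b c a d
IsMinimal-rotate {a} {b} {c} {d} (nc , inT , d≢a , d≢b , d≢c , only) =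
  nc ∘ trans (sym (orient-rotate a b c)) , InTri-rotate {a} {b} {c} {d} inT , d≢b , d≢c , d≢a ,
  λ p i → perm (only p (InTri-rotate {c} {a} {b} {p} (InTri-rotate {b} {c} {a} {p} i)))
  where
  perm : ∀ {A B C D : Set} → A ⊎ B ⊎ C ⊎ D → B ⊎ C ⊎ A ⊎ D
  perm (inj₁ a) = inj₂ (inj₂ (inj₁ a))
  perm (inj₂ (inj₁ b)) = inj₁ b
  perm (inj₂ (inj₂ (inj₁ c))) = inj₂ (inj₁ c)
  perm (inj₂ (inj₂ (inj₂ d))) = inj₂ (inj₂ (inj₂ d))

IsMinimal-swap : ∀ {a b c d} → IsMinimal a b c d → IsMinimal b a c d
IsMinimal-swap {a} {b} {c} {d} (nc , inT , d≢a , d≢b , d≢c , only) =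
  (λ e → nc (trans (orient-flip b a c) (cong -_ e))) , InTri-swap {a} {b} {c} {d} inT , d≢b , d≢a , d≢c ,
  λ p i → perm (only p (InTri-swap {b} {a} {c} {p} i))
  where
  perm : ∀ {A B C D : Set} → A ⊎ B ⊎ C ⊎ D → B ⊎ A ⊎ C ⊎ D
  perm (inj₁ a) = inj₂ (inj₁ a)
  perm (inj₂ (inj₁ b)) = inj₁ b
  perm (inj₂ (inj₂ x)) = inj₂ (inj₂ x)

orient-sum : ∀ a b c d → orient a b c ≡ (orient d b c + orient d c a) + orient d a b
orient-sum (a₁ , a₂) (b₁ , b₂) (c₁ , c₂) (d₁ , d₂) =
  solve 8 (λ a₁ a₂ b₁ b₂ c₁ c₂ d₁ d₂ → let a = a₁ , a₂ ; b = b₁ , b₂ ; c = c₁ , c₂ ; d = d₁ , d₂ in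
    orientᵖ a b c := (orientᵖ d b c :+ orientᵖ d c a) :+ orientᵖ d a b) refl a₁ a₂ b₁ b₂ c₁ c₂ d₁ d₂

module _ (a b c d : Point) where
  private
    A B C : ℤ
    A = orient d b c
    B = orient d c a
    C = orient d a b
    a₁ = proj₁ a
    a₂ = proj₂ a
    b₁ = proj₁ b
    b₂ = proj₂ b
    c₁ = proj₁ c
    c₂ = proj₂ c
    d₁ = proj₁ d
    d₂ = proj₂ d

  -- Cramer's rule: the three orientations at `d` are its unnormalised barycentric coordinates.
  -- Weights 1, 1, 0 make `d` a midpoint, weights 1, 1, 1 a centroid, and two zero weights a vertex.
  barycentric₁ : (A * (a₁ - d₁) + B * (b₁ - d₁)) + C * (c₁ - d₁) ≡ 0ℤ
  barycentric₁ = solve 8 (λ a₁ a₂ b₁ b₂ c₁ c₂ d₁ d₂ → let a = a₁ , a₂ ; b = b₁ , b₂ ; c = c₁ , c₂ ; d = d₁ , d₂ in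
    (orientᵖ d b c :* (a₁ :- d₁) :+ orientᵖ d c a :* (b₁ :- d₁)) :+ orientᵖ d a b :* (c₁ :- d₁) := con 0ℤ)
    refl a₁ a₂ b₁ b₂ c₁ c₂ d₁ d₂

  barycentric₂ : (A * (a₂ - d₂) + B * (b₂ - d₂)) + C * (c₂ - d₂) ≡ 0ℤ
  barycentric₂ = solve 8 (λ a₁ a₂ b₁ b₂ c₁ c₂ d₁ d₂ → let a = a₁ , a₂ ; b = b₁ , b₂ ; c = c₁ , c₂ ; d = d₁ , d₂ in
    (orientᵖ d b c :* (a₂ :- d₂) :+ orientᵖ d c a :* (b₂ :- d₂)) :+ orientᵖ d a b :* (c₂ :- d₂) := con 0ℤ)
    refl a₁ a₂ b₁ b₂ c₁ c₂ d₁ d₂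

  zero-weights : A ≡ 0ℤ → B ≡ 0ℤ → 0ℤ < C → c ≡ d
  zero-weights A≡0 B≡0 0<C = cong₂ _,_ (eq a₁ b₁ c₁ d₁ barycentric₁) (eq a₂ b₂ c₂ d₂ barycentric₂)
    where
    eq : ∀ a b c d → (A * (a - d) + B * (b - d)) + C * (c - d) ≡ 0ℤ → c ≡ d
    eq a b c d e = ℤₚ.i-j≡0⇒i≡j c d (*-cancel-0 C 0<C
      (trans (solve 4 (λ x y z C → C :* z := (con 0ℤ :* x :+ con 0ℤ :* y) :+ C :* z) refl (a - d) (b - d) (c - d) C)
      (trans (cong₂ (λ p q → (p * (a - d) + q * (b - d)) + C * (c - d)) (sym A≡0) (sym B≡0)) e)))

  border-weights : A ≡ 1ℤ → B ≡ 1ℤ → C ≡ 0ℤ → Border a b c d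
  border-weights A≡1 B≡1 C≡0 = border (±1⇒Unit (inj₁ B≡1))
    (cong₂ _,_ (eq a₁ b₁ c₁ d₁ barycentric₁) (eq a₂ b₂ c₂ d₂ barycentric₂))
    where
    eq : ∀ a b c d → (A * (a - d) + B * (b - d)) + C * (c - d) ≡ 0ℤ → b ≡ + 2 * d - a
    eq a b c d e = ℤₚ.i-j≡0⇒i≡j b (+ 2 * d - a) (trans
      (solve 4 (λ a b c d → b :- (con (+ 2) :* d :- a) := (con 1ℤ :* (a :- d) :+ con 1ℤ :* (b :- d)) :+ con 0ℤ :* (c :- d)) refl a b c d)
      (trans (cong₂ (λ p q → (p * (a - d) + q * (b - d)) + 0ℤ * (c - d)) (sym A≡1) (sym B≡1))
      (trans (cong (λ r → (A * (a - d) + B * (b - d)) + r * (c - d)) (sym C≡0)) e)))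

  internal-weights : A ≡ 1ℤ → B ≡ 1ℤ → C ≡ 1ℤ → Internal a b c d
  internal-weights A≡1 B≡1 C≡1 = internal (±1⇒Unit (inj₁ C≡1))
    (cong₂ _,_ (eq a₁ b₁ c₁ d₁ barycentric₁) (eq a₂ b₂ c₂ d₂ barycentric₂))
    where
    eq : ∀ a b c d → (A * (a - d) + B * (b - d)) + C * (c - d) ≡ 0ℤ → c ≡ (+ 3 * d - a) - b
    eq a b c d e = ℤₚ.i-j≡0⇒i≡j c ((+ 3 * d - a) - b) (trans
      (solve 4 (λ a b c d → c :- ((con (+ 3) :* d :- a) :- b) := (con 1ℤ :* (a :- d) :+ con 1ℤ :* (b :- d)) :+ con 1ℤ :* (c :- d)) refl a b c d)
      (trans (cong₂ (λ p q → (p * (a - d) + q * (b - d)) + 1ℤ * (c - d)) (sym A≡1) (sym B≡1))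
      (trans (cong (λ r → (A * (a - d) + B * (b - d)) + r * (c - d)) (sym C≡1)) e)))

  module Positive (m : IsMinimal a b c d) (0<T : 0ℤ < orient a b c) where
    private
      inT = proj₁ (proj₂ m)

    0≤A : 0ℤ ≤ A
    0≤A = subst (0ℤ ≤_) (orient-rotate d b c) (0≤-cancel _ 0<T (proj₁ (proj₂ inT)))

    0≤B : 0ℤ ≤ B
    0≤B = subst (0ℤ ≤_) (orient-rotate d c a) (0≤-cancel _ 0<T (proj₂ (proj₂ inT)))

    0≤C : 0ℤ ≤ C
    0≤C = subst (0ℤ ≤_) (orient-rotate d a b) (0≤-cancel _ 0<T (proj₁ inT))

    -- The point d ⊕ r of the triangle d a b has weights i and j at a and b, and
    -- nonnegative weights with respect to the triangle a b c, up to the scale C.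
    subtriangle-empty : 0ℤ < C → ∀ r → 0ℤ ≤ det2 r (b ⊖ d) → 0ℤ ≤ det2 (a ⊖ d) r →
      0ℤ ≤ (C - det2 r (b ⊖ d)) - det2 (a ⊖ d) r → r ≡ (0ℤ , 0ℤ) ⊎ r ≡ a ⊖ d ⊎ r ≡ b ⊖ d
    subtriangle-empty 0<C r@(r₁ , r₂) 0≤i 0≤j 0≤k = locate (proj₂ (proj₂ (proj₂ (proj₂ (proj₂ m)))) (d ⊕ r)
      ( 0≤-* 0≤T (subst (0ℤ ≤_) ab 0≤k)
      , 0≤-* 0≤T (0≤-cancel C 0<C (subst (0ℤ ≤_) bc (0≤-+ (0≤-+ (0≤-* 0≤A (0≤-+ 0≤k 0≤i)) (0≤-* 0≤i 0≤B)) (0≤-* 0≤i 0≤C))))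
      , 0≤-* 0≤T (0≤-cancel C 0<C (subst (0ℤ ≤_) ca (0≤-+ (0≤-+ (0≤-* 0≤B (0≤-+ 0≤k 0≤j)) (0≤-* 0≤j 0≤A)) (0≤-* 0≤j 0≤C)))) ))
      where
      0≤T : 0ℤ ≤ orient a b c
      0≤T = ℤₚ.<⇒≤ 0<T
      i j k : ℤ
      i = det2 r (b ⊖ d)
      j = det2 (a ⊖ d) r
      k = (C - i) - j
      ab : k ≡ orient a b (d ⊕ r)
      ab = solve 8 (λ a₁ a₂ b₁ b₂ d₁ d₂ r₁ r₂ → let a = a₁ , a₂ ; b = b₁ , b₂ ; d = d₁ , d₂ ; r = r₁ , r₂ in
        (orientᵖ d a b :- det2ᵖ r (b ⊖ᵖ d)) :- det2ᵖ (a ⊖ᵖ d) r := orientᵖ a b (d ⊕ᵖ r))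
        refl a₁ a₂ b₁ b₂ d₁ d₂ r₁ r₂
      bc : (A * (k + i) + i * B) + i * C ≡ C * orient b c (d ⊕ r)
      bc = solve 10 (λ a₁ a₂ b₁ b₂ c₁ c₂ d₁ d₂ r₁ r₂ →
        let a = a₁ , a₂ ; b = b₁ , b₂ ; c = c₁ , c₂ ; d = d₁ , d₂ ; r = r₁ , r₂
            A = orientᵖ d b c ; B = orientᵖ d c a ; C = orientᵖ d a b
            i = det2ᵖ r (b ⊖ᵖ d) ; j = det2ᵖ (a ⊖ᵖ d) r ; k = (C :- i) :- j in
        (A :* (k :+ i) :+ i :* B) :+ i :* C := C :* orientᵖ b c (d ⊕ᵖ r))
        refl a₁ a₂ b₁ b₂ c₁ c₂ d₁ d₂ r₁ r₂
      ca : (B * (k + j) + j * A) + j * C ≡ C * orient c a (d ⊕ r)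
      ca = solve 10 (λ a₁ a₂ b₁ b₂ c₁ c₂ d₁ d₂ r₁ r₂ →
        let a = a₁ , a₂ ; b = b₁ , b₂ ; c = c₁ , c₂ ; d = d₁ , d₂ ; r = r₁ , r₂
            A = orientᵖ d b c ; B = orientᵖ d c a ; C = orientᵖ d a b
            i = det2ᵖ r (b ⊖ᵖ d) ; j = det2ᵖ (a ⊖ᵖ d) r ; k = (C :- i) :- j in
        (B :* (k :+ j) :+ j :* A) :+ j :* C := C :* orientᵖ c a (d ⊕ᵖ r))
        refl a₁ a₂ b₁ b₂ c₁ c₂ d₁ d₂ r₁ r₂
      difference : ∀ {p} → d ⊕ r ≡ p → r ≡ p ⊖ d
      difference refl = cong₂ _,_ (eq d₁ r₁) (eq d₂ r₂)
        where
        eq : ∀ d r → r ≡ (d + r) - d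
        eq = solve 2 (λ d r → r := (d :+ r) :- d) refl
      c≢r : r ≢ c ⊖ d
      c≢r refl = proj₁ (proj₂ (proj₂ (proj₂ (proj₂ m)))) (sym (zero-weights
        (0≤-antisym 0≤A (subst (0ℤ ≤_) (solve 4 (λ b₁ b₂ c₁ c₂ → c₁ :* b₂ :- b₁ :* c₂ := :- (b₁ :* c₂ :- c₁ :* b₂))
          refl (b₁ - d₁) (b₂ - d₂) (c₁ - d₁) (c₂ - d₂)) 0≤i))
        (0≤-antisym 0≤B (subst (0ℤ ≤_) (solve 4 (λ a₁ a₂ c₁ c₂ → a₁ :* c₂ :- c₁ :* a₂ := :- (c₁ :* a₂ :- a₁ :* c₂))
          refl (a₁ - d₁) (a₂ - d₂) (c₁ - d₁) (c₂ - d₂)) 0≤j))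
        0<C))
      locate : (d ⊕ r ≡ a) ⊎ (d ⊕ r ≡ b) ⊎ (d ⊕ r ≡ c) ⊎ (d ⊕ r ≡ d) → r ≡ (0ℤ , 0ℤ) ⊎ r ≡ a ⊖ d ⊎ r ≡ b ⊖ d
      locate (inj₁ e) = inj₂ (inj₁ (difference e))
      locate (inj₂ (inj₁ e)) = inj₂ (inj₂ (difference e))
      locate (inj₂ (inj₂ (inj₁ e))) = ⊥-elim (c≢r (difference e))
      locate (inj₂ (inj₂ (inj₂ e))) = inj₁ (trans (difference e) (cong₂ _,_ (ℤₚ.+-inverseʳ d₁) (ℤₚ.+-inverseʳ d₂)))

    -- A positive weight is the determinant of the triangle `d a b`, which lies in `a b c` and
    -- contains no lattice point besides its vertices.
    weight-0∨1 : C ≡ 0ℤ ⊎ C ≡ 1ℤ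
    weight-0∨1 with 0≤⇒ℕ 0≤C
    ... | zero , e = inj₁ e
    ... | suc n , e = inj₂ (EmptyTriangle.unimodular (a ⊖ d) (b ⊖ d) n e
                             (subtriangle-empty (subst (0ℤ <_) (sym e) (+<+ (s≤s z≤n)))))

Classification : Point → Point → Point → Point → Set
Classification a b c d = Internal a b c d ⊎ Border a b c d ⊎ Border b c a d ⊎ Border c a b d

-- Weights in {0, 1} leave eight cases. No zero gives an internal triangle; one zero gives a border
-- triangle whose apex is the vertex of weight zero; two zeros put `d` at a vertex, and three make
-- the triangle degenerate.
classify⁺ : ∀ {a b c d} → IsMinimal a b c d → 0ℤ < orient a b c → Classification a b c d
classify⁺ {a} {b} {c} {d} m 0<T =
  decide (Positive.weight-0∨1 b c a d m′ 0<T′) (Positive.weight-0∨1 c a b d m″ 0<T″) (Positive.weight-0∨1 a b c d m 0<T)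
  where
  m′ = IsMinimal-rotate {a} {b} {c} {d} m
  m″ = IsMinimal-rotate {b} {c} {a} {d} m′
  0<T′ : 0ℤ < orient b c a
  0<T′ = subst (0ℤ <_) (sym (orient-rotate a b c)) 0<T
  0<T″ : 0ℤ < orient c a b
  0<T″ = subst (0ℤ <_) (sym (orient-rotate b c a)) 0<T′
  0<_ : ∀ {z} → z ≡ 1ℤ → 0ℤ < z
  0< refl = +<+ (s≤s z≤n)
  decide : orient d b c ≡ 0ℤ ⊎ orient d b c ≡ 1ℤ → orient d c a ≡ 0ℤ ⊎ orient d c a ≡ 1ℤ →
           orient d a b ≡ 0ℤ ⊎ orient d a b ≡ 1ℤ → Classification a b c d
  decide (inj₂ A≡1) (inj₂ B≡1) (inj₂ C≡1) = inj₁ (internal-weights a b c d A≡1 B≡1 C≡1)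
  decide (inj₂ A≡1) (inj₂ B≡1) (inj₁ C≡0) = inj₂ (inj₁ (border-weights a b c d A≡1 B≡1 C≡0))
  decide (inj₁ A≡0) (inj₂ B≡1) (inj₂ C≡1) = inj₂ (inj₂ (inj₁ (border-weights b c a d B≡1 C≡1 A≡0)))
  decide (inj₂ A≡1) (inj₁ B≡0) (inj₂ C≡1) = inj₂ (inj₂ (inj₂ (border-weights c a b d C≡1 A≡1 B≡0)))
  decide (inj₁ A≡0) (inj₁ B≡0) (inj₂ C≡1) =
    ⊥-elim (proj₁ (proj₂ (proj₂ (proj₂ (proj₂ m)))) (sym (zero-weights a b c d A≡0 B≡0 (0< C≡1))))
  decide (inj₂ A≡1) (inj₁ B≡0) (inj₁ C≡0) =
    ⊥-elim (proj₁ (proj₂ (proj₂ m)) (sym (zero-weights b c a d B≡0 C≡0 (0< A≡1))))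
  decide (inj₁ A≡0) (inj₂ B≡1) (inj₁ C≡0) =
    ⊥-elim (proj₁ (proj₂ (proj₂ (proj₂ m))) (sym (zero-weights c a b d C≡0 A≡0 (0< B≡1))))
  decide (inj₁ A≡0) (inj₁ B≡0) (inj₁ C≡0) =
    ⊥-elim (proj₁ m (trans (orient-sum a b c d) (cong₂ _+_ (cong₂ _+_ A≡0 B≡0) C≡0)))

classify : ∀ {a b c d} → IsMinimal a b c d → Classification a b c d
classify {a} {b} {c} {d} m with ℤₚ.<-cmp 0ℤ (orient a b c)
... | tri< 0<T _ _ = classify⁺ {a} {b} {c} {d} m 0<T
... | tri≈ _ 0≡T _ = ⊥-elim (proj₁ m (sym 0≡T))
... | tri> _ _ T<0 = unswap (classify⁺ {b} {a} {c} {d} (IsMinimal-swap {a} {b} {c} {d} m)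
        (subst (0ℤ <_) (sym (orient-flip a b c)) (ℤₚ.neg-mono-< T<0)))
  where
  unswap : Classification b a c d → Classification a b c d
  unswap (inj₁ i) = inj₁ (Internal-swap i)
  unswap (inj₂ (inj₁ e)) = inj₂ (inj₁ (Border-swap e))
  unswap (inj₂ (inj₂ (inj₁ e))) = inj₂ (inj₂ (inj₂ (Border-swap e)))
  unswap (inj₂ (inj₂ (inj₂ e))) = inj₂ (inj₂ (inj₁ (Border-swap e)))

IsInternal⇒Internal : ∀ {a b c d} → IsInternal a b c d → Internal a b c d
IsInternal⇒Internal {a} {b} {c} {d} (m , interior) with classify {a} {b} {c} {d} m
... | inj₁ i = i
... | inj₂ (inj₁ e) = ⊥-elim (proj₂ (proj₂ (Border⇒IsBorder {a} {b} {c} {d} e)) interior)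
... | inj₂ (inj₂ (inj₁ e)) = ⊥-elim (proj₂ (proj₂ (Border⇒IsBorder {b} {c} {a} {d} e)) (InInterior-rotate {a} {b} {c} {d} interior))
... | inj₂ (inj₂ (inj₂ e)) = ⊥-elim (proj₂ (proj₂ (Border⇒IsBorder {c} {a} {b} {d} e))
        (InInterior-rotate {b} {c} {a} {d} (InInterior-rotate {a} {b} {c} {d} interior)))

IsBorder⇒Border : ∀ {a b c d} → IsBorder a b c d → Border a b c d ⊎ Border b c a d ⊎ Border c a b d
IsBorder⇒Border {a} {b} {c} {d} (m , _ , not-interior) with classify {a} {b} {c} {d} m
... | inj₁ i = ⊥-elim (not-interior (proj₂ (Internal⇒IsInternal {a} {b} {c} {d} i)))
... | inj₂ e = e

-- Stable and free sets

ExactlyThree-rotate : ∀ {S a b c d} → ExactlyThree S a b c d → ExactlyThree S b c a d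
ExactlyThree-rotate (inj₁ (¬a , b , c , d))               = inj₂ (inj₂ (inj₁ (b , c , ¬a , d)))
ExactlyThree-rotate (inj₂ (inj₁ (a , ¬b , c , d)))        = inj₁ (¬b , c , a , d)
ExactlyThree-rotate (inj₂ (inj₂ (inj₁ (a , b , ¬c , d)))) = inj₂ (inj₁ (b , ¬c , a , d))
ExactlyThree-rotate (inj₂ (inj₂ (inj₂ (a , b , c , ¬d)))) = inj₂ (inj₂ (inj₂ (b , c , a , ¬d)))

IClosed⇒IStable : ∀ {S} → IClosed S → IStable S
IClosed⇒IStable {S} cl a b c d t three = refute (IsInternal⇒Internal {a} {b} {c} {d} t) three
  where
  refute : Internal a b c d → ¬ ExactlyThree S a b c d
  refute i (inj₁ (¬a , b , c , d))               = ¬a (corner cl (Internal-rotate i) b c d)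
  refute i (inj₂ (inj₁ (a , ¬b , c , d)))        = ¬b (corner cl (Internal-rotate (Internal-rotate i)) c a d)
  refute i (inj₂ (inj₂ (inj₁ (a , b , ¬c , d)))) = ¬c (corner cl i a b d)
  refute i (inj₂ (inj₂ (inj₂ (a , b , c , ¬d)))) = ¬d (centre cl i a b c)

-- Up to exchanging the two ends, the constructors omit the apex, an end and the midpoint in turn.
-- The omitted point is hidden, so that freeness is a condition on the three points present.
data BTriple : Point → Point → Point → Set where
  two-ends-middle : ∀ {a b c d} → Border a b c d → BTriple a b d
  end-apex-middle : ∀ {a b c d} → Border a b c d → BTriple a c d
  vertices        : ∀ {a b c d} → Border a b c d → BTriple a b c

data ITriple : Point → Point → Point → Set where
  two-vertices-centre : ∀ {a b c d} → Internal a b c d → ITriple a b d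
  vertices            : ∀ {a b c d} → Internal a b c d → ITriple a b c

BITriple : Point → Point → Point → Set
BITriple x y z = BTriple x y z ⊎ ITriple x y z

Free : (Point → Point → Point → Set) → Subset → Set
Free T S = ∀ {x y z} → T x y z → S x → S y → S z → ⊥

Free-⊆ : ∀ {T} {S S′ : Subset} → S′ ⊆ S → Free T S → Free T S′
Free-⊆ S′⊆S free t x y z = free t (S′⊆S x) (S′⊆S y) (S′⊆S z)

Free-B⇒BStable : ∀ {S} → Free BTriple S → BStable S
Free-B⇒BStable {S} free a b c d t three = by-edge (IsBorder⇒Border {a} {b} {c} {d} t)
  where
  refute : ∀ {a b c d} → Border a b c d → ¬ ExactlyThree S a b c d
  refute e (inj₁ (_ , b , c , d))               = free (end-apex-middle (Border-swap e)) b c d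
  refute e (inj₂ (inj₁ (a , _ , c , d)))        = free (end-apex-middle e) a c d
  refute e (inj₂ (inj₂ (inj₁ (a , b , _ , d)))) = free (two-ends-middle e) a b d
  refute e (inj₂ (inj₂ (inj₂ (a , b , c , _)))) = free (vertices e) a b c
  by-edge : Border a b c d ⊎ Border b c a d ⊎ Border c a b d → ⊥
  by-edge (inj₁ e)        = refute e three
  by-edge (inj₂ (inj₁ e)) = refute e (ExactlyThree-rotate {S} {a} {b} {c} {d} three)
  by-edge (inj₂ (inj₂ e)) = refute e (ExactlyThree-rotate {S} {b} {c} {a} {d} (ExactlyThree-rotate {S} {a} {b} {c} {d} three))

Free-I⇒IStable : ∀ {S} → Free ITriple S → IStable S
Free-I⇒IStable {S} free a b c d t three = refute (IsInternal⇒Internal {a} {b} {c} {d} t) three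
  where
  refute : Internal a b c d → ¬ ExactlyThree S a b c d
  refute i (inj₁ (_ , b , c , d))               = free (two-vertices-centre (Internal-rotate i)) b c d
  refute i (inj₂ (inj₁ (a , _ , c , d)))        = free (two-vertices-centre (Internal-rotate (Internal-rotate i))) c a d
  refute i (inj₂ (inj₂ (inj₁ (a , b , _ , d)))) = free (two-vertices-centre i) a b d
  refute i (inj₂ (inj₂ (inj₂ (a , b , c , _)))) = free (vertices i) a b c

Free-BI⇒BIStable : ∀ {S} → Free BITriple S → BIStable S
Free-BI⇒BIStable {S} free = Free-B⇒BStable {S} (λ t → free (inj₁ t)) , Free-I⇒IStable {S} (λ t → free (inj₂ t))

≐-image : ∀ U {X S : Subset} → S ∘ applyU U ≐ X → S ≐ image U X
≐-image U {X} {S} (to , from) =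
  (λ {p} s → applyU (inverse U) p , to {applyU (inverse U) p} (subst S (sym (applyU-inverseʳ U p)) s) , applyU-inverseʳ U p) ,
  λ { (x , Xx , refl) → from {x} Xx }

-- Enumeration of the plane and greedy extension

ℤ→ℕ : ℤ → ℕ
ℤ→ℕ (+ n)    = 2 ℕ.* n
ℤ→ℕ -[1+ n ] = suc (2 ℕ.* n)

ℤ→ℕ-injective : ∀ {x y} → ℤ→ℕ x ≡ ℤ→ℕ y → x ≡ y
ℤ→ℕ-injective {+ m}      {+ n}      e = cong +_ (ℕₚ.*-cancelˡ-≡ m n 2 e)
ℤ→ℕ-injective {+ m}      { -[1+ n ]} e = ⊥-elim (ℕₚ.even≢odd m n e)
ℤ→ℕ-injective { -[1+ m ]} {+ n}      e = ⊥-elim (ℕₚ.even≢odd n m (sym e))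
ℤ→ℕ-injective { -[1+ m ]} { -[1+ n ]} e = cong -[1+_] (ℕₚ.*-cancelˡ-≡ m n 2 (ℕₚ.suc-injective e))

-- Cantor's pairing with the square of `a + b` in place of a triangular number, which avoids
-- halving. The greedy construction relies only on distinct points having distinct codes.
pair : ℕ → ℕ → ℕ
pair a b = (a ℕ.+ b) ℕ.* (a ℕ.+ b) ℕ.+ a

-- The square root of pair a b, rounded down, is a + b.
pair-mono : ∀ a b a′ b′ → a ℕ.+ b ℕ.< a′ ℕ.+ b′ → pair a b ℕ.< pair a′ b′
pair-mono a b a′ b′ s<s′ = begin-strict
  s ℕ.* s ℕ.+ a               ≤⟨ ℕₚ.+-monoʳ-≤ (s ℕ.* s) (ℕₚ.m≤m+n a b) ⟩
  s ℕ.* s ℕ.+ s               ≡⟨ ℕₚ.+-comm (s ℕ.* s) s ⟩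
  s ℕ.+ s ℕ.* s               ≡⟨ refl ⟩
  suc s ℕ.* s                 <⟨ ℕₚ.*-monoʳ-< (suc s) (ℕₚ.n<1+n s) ⟩
  suc s ℕ.* suc s             ≤⟨ ℕₚ.*-mono-≤ s<s′ s<s′ ⟩
  s′ ℕ.* s′                   ≤⟨ ℕₚ.m≤m+n (s′ ℕ.* s′) a′ ⟩
  s′ ℕ.* s′ ℕ.+ a′            ∎
  where
  open ℕₚ.≤-Reasoning
  s s′ : ℕ
  s = a ℕ.+ b
  s′ = a′ ℕ.+ b′

pair-injective : ∀ a b a′ b′ → pair a b ≡ pair a′ b′ → a ≡ a′ × b ≡ b′
pair-injective a b a′ b′ e with ℕₚ.<-cmp (a ℕ.+ b) (a′ ℕ.+ b′)
... | tri< lt _ _ = ⊥-elim (ℕₚ.<⇒≢ (pair-mono a b a′ b′ lt) e)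
... | tri> _ _ gt = ⊥-elim (ℕₚ.<⇒≢ (pair-mono a′ b′ a b gt) (sym e))
... | tri≈ _ eq _ = a≡a′ , ℕₚ.+-cancelˡ-≡ a b b′ (trans eq (cong (ℕ._+ b′) (sym a≡a′)))
  where
  a≡a′ : a ≡ a′
  a≡a′ = ℕₚ.+-cancelˡ-≡ ((a ℕ.+ b) ℕ.* (a ℕ.+ b)) a a′
    (trans e (cong (λ s → s ℕ.* s ℕ.+ a′) (sym eq)))

code : Point → ℕ
code (x , y) = pair (ℤ→ℕ x) (ℤ→ℕ y)

code-injective : ∀ {p q} → code p ≡ code q → p ≡ q
code-injective {x , y} {x′ , y′} e with pair-injective (ℤ→ℕ x) (ℤ→ℕ y) (ℤ→ℕ x′) (ℤ→ℕ y′) e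
... | ex , ey = cong₂ _,_ (ℤ→ℕ-injective ex) (ℤ→ℕ-injective ey)

-- The points are added one at a time, in the order of their codes, as long as the set stays free.
module Greedy (T : Point → Point → Point → Set) (S : Subset) where

  stage : ℕ → Subset
  stage zero    p = S p
  stage (suc n) p = stage n p ⊎ (code p ≡ n × Free T (λ q → stage n q ⊎ q ≡ p))

  greedy : Subset
  greedy p = ∃[ n ] stage n p

  stage-mono : ∀ {m n} → m ℕ.≤′ n → stage m ⊆ stage n
  stage-mono ℕ.≤′-refl      s = s
  stage-mono (ℕ.≤′-step le) s = inj₁ (stage-mono le s)

  -- Points that enter at the same stage share a code and hence coincide. A forbidden triple with a
  -- new point would thus lie in the very set whose freeness was recorded on entry.
  stage-free : Free T S → ∀ n → Free T (stage n)
  stage-free free zero    = free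
  stage-free free (suc n) {x} {y} {z} t sx sy sz = by-new sx sy sz
    where
    lift : ∀ {p q} → code p ≡ n → stage (suc n) q → stage n q ⊎ q ≡ p
    lift cp (inj₁ s)        = inj₁ s
    lift cp (inj₂ (cq , _)) = inj₂ (code-injective (trans cq (sym cp)))
    by-new : stage (suc n) x → stage (suc n) y → stage (suc n) z → ⊥
    by-new (inj₁ sx) (inj₁ sy) (inj₁ sz)       = stage-free free n t sx sy sz
    by-new (inj₂ (c , f)) sy sz                = f t (inj₂ refl) (lift c sy) (lift c sz)
    by-new (inj₁ sx) (inj₂ (c , f)) sz         = f t (inj₁ sx) (inj₂ refl) (lift c sz)
    by-new (inj₁ sx) (inj₁ sy) (inj₂ (c , f))  = f t (inj₁ sx) (inj₁ sy) (inj₂ refl)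

  greedy-free : Free T S → Free T greedy
  greedy-free free t (l , sx) (m , sy) (n , sz) = stage-free free (l ℕ.⊔ m ℕ.⊔ n) t
    (stage-mono (ℕₚ.≤⇒≤′ (ℕₚ.≤-trans (ℕₚ.m≤m⊔n l m) (ℕₚ.m≤m⊔n (l ℕ.⊔ m) n))) sx)
    (stage-mono (ℕₚ.≤⇒≤′ (ℕₚ.≤-trans (ℕₚ.m≤n⊔m l m) (ℕₚ.m≤m⊔n (l ℕ.⊔ m) n))) sy)
    (stage-mono (ℕₚ.≤⇒≤′ (ℕₚ.m≤n⊔m (l ℕ.⊔ m) n)) sz)

  S⊆greedy : S ⊆ greedy
  S⊆greedy s = zero , s

  -- When the turn of `p` comes, the current stage together with `p` still lies in the free set
  -- `S′`, so `p` is accepted at stage `code p`.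
  greedy-maximal : ∀ {S′} → Free T S′ → greedy ⊆ S′ → S′ ⊆ greedy
  greedy-maximal {S′} free G⊆S′ {p} s′ = suc (code p) , inj₂ (refl ,
    Free-⊆ {S = S′} {S′ = λ q → stage (code p) q ⊎ q ≡ p} (λ { (inj₁ s) → G⊆S′ (code p , s) ; (inj₂ refl) → s′ }) free)

-- Heredity and maximal sets, with excluded middle

module Classical (em : ExcludedMiddle 0ℓ) where

  by-contradiction : ∀ {P : Set} → ¬ ¬ P → P
  by-contradiction {P} ¬¬p with em {P}
  ... | yes p = p
  ... | no ¬p = ⊥-elim (¬¬p ¬p)

  IStable⇒IClosed : ∀ {S} → IStable S → IClosed S
  IStable⇒IClosed st = record
    { centre = λ {a} {b} {c} {d} i pa pb pc → by-contradiction λ ¬d →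
        st a b c d (Internal⇒IsInternal i) (inj₂ (inj₂ (inj₂ (pa , pb , pc , ¬d))))
    ; corner = λ {a} {b} {c} {d} i pa pb pd → by-contradiction λ ¬c →
        st a b c d (Internal⇒IsInternal i) (inj₂ (inj₂ (inj₁ (pa , pb , ¬c , pd)))) }

  BStable⇒BClosed : ∀ {S} → BStable S → BClosed S
  BStable⇒BClosed st = record
    { apex = λ {a} {b} {c} {d} e pa pb pd → by-contradiction λ ¬c →
        st a b c d (Border⇒IsBorder e) (inj₂ (inj₂ (inj₁ (pa , pb , ¬c , pd))))
    ; endpoint = λ {a} {b} {c} {d} e pa pc pd → by-contradiction λ ¬b →
        st a b c d (Border⇒IsBorder e) (inj₂ (inj₁ (pa , ¬b , pc , pd)))
    ; midpoint = λ {a} {b} {c} {d} e pa pb pc → by-contradiction λ ¬d →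
        st a b c d (Border⇒IsBorder e) (inj₂ (inj₂ (inj₂ (pa , pb , pc , ¬d)))) }

  BStable⇒Free : ∀ {S} → BStable S → Proper S → Free BTriple S
  BStable⇒Free {S} st (p , ¬p) = refute
    where
    cl : BClosed S
    cl = BStable⇒BClosed st
    refute : Free BTriple S
    refute (two-ends-middle e) a b d = ¬p (unit-triangle-full cl (Border.border-unit e) (apex cl e a b d) a d p)
    refute (end-apex-middle e) a c d = ¬p (unit-triangle-full cl (Border.border-unit e) c a d p)
    refute (vertices e) a b c        = ¬p (unit-triangle-full cl (Border.border-unit e) c a (midpoint cl e a b c) p)

  -- Two vertices and the centre of an internal triangle form a unimodular triangle, from which the
  -- border rule generates the plane; the internal rule serves to obtain the centre from three
  -- vertices.
  BIStable⇒Free : ∀ {S} → BIStable S → Proper S → Free BITriple S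
  BIStable⇒Free {S} (bst , ist) proper (inj₁ t) = BStable⇒Free bst proper t
  BIStable⇒Free {S} (bst , ist) (p , ¬p) (inj₂ t) = refute t
    where
    cl : BClosed S
    cl = BStable⇒BClosed bst
    refute : Free ITriple S
    refute (two-vertices-centre i) a b d = ¬p (unit-triangle-full cl (Internal.internal-unit i) a b d p)
    refute (vertices i) a b c            =
      ¬p (unit-triangle-full cl (Internal.internal-unit i) a b (centre (IStable⇒IClosed ist) i a b c) p)

  Free⇒Proper : ∀ {T S} → T (1ℤ , 0ℤ) (0ℤ , 1ℤ) (0ℤ , 0ℤ) → Free T S → Proper S
  Free⇒Proper {T} {S} t free with em {S (1ℤ , 0ℤ)} | em {S (0ℤ , 1ℤ)} | em {S (0ℤ , 0ℤ)}
  ... | yes a | yes b | yes c = ⊥-elim (free t a b c)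
  ... | no ¬a | _     | _     = _ , ¬a
  ... | yes _ | no ¬b | _     = _ , ¬b
  ... | yes _ | yes _ | no ¬c = _ , ¬c

  unit-BTriple : BTriple (1ℤ , 0ℤ) (0ℤ , 1ℤ) (0ℤ , 0ℤ)
  unit-BTriple = end-apex-middle (border (unit refl) refl)

  unit-ITriple : ITriple (1ℤ , 0ℤ) (0ℤ , 1ℤ) (0ℤ , 0ℤ)
  unit-ITriple = two-vertices-centre (internal (unit refl) refl)

  ∄⇒⊆ : ∀ {P Q : Subset} → ¬ (∃[ p ] (P p × ¬ Q p)) → P ⊆ Q
  ∄⇒⊆ ∄ Pp = by-contradiction λ ¬Qp → ∄ (_ , Pp , ¬Qp)

  internal-classification : ∀ {S a b c d} → IClosed S → Internal a b c d → S a → S b → S c → S d →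
    UnimodImage J¼ S ⊎ UnimodImage J½ S ⊎ UnimodImage Full S
  internal-classification {S} {a} {b} {_} {d} cl (internal u refl) pa pb pc pd = extend em
    where
    U : Unimodular
    U = frame d a b u
    P : Subset
    P = S ∘ applyU U
    clP : IClosed P
    clP = IClosed-U {S} U cl
    J¼⊆P : J¼ ⊆ P
    J¼⊆P = J¼-fill {P} clP
      ( subst S (sym (frame-00 d a b u)) pd , subst S (sym (frame-10 d a b u)) pa
      , subst S (sym (frame-01 d a b u)) pb , subst S (sym (frame-third d a b u)) pc )
    extend₂ : ∀ V → J½ ⊆ P ∘ applyU V → Dec (∃[ p ] (P (applyU V p) × ¬ J½ p)) →
              UnimodImage J½ S ⊎ UnimodImage Full S
    extend₂ V J½⊆Q (no ∄) = inj₁ (U ∘ᵁ V , ≐-image (U ∘ᵁ V) {S = S}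
      ( (λ {p} s → ∄⇒⊆ {P ∘ applyU V} {J½} ∄ {p} (subst S (applyU-∘ U V p) s))
      , λ {p} j → subst S (sym (applyU-∘ U V p)) (J½⊆Q {p} j)))
    extend₂ V J½⊆Q (yes (q , Pq , q∉J½)) = inj₂ (U ∘ᵁ V , ≐-image (U ∘ᵁ V) {S = S}
      -- `Full x` unfolds to `Point`, so the point itself is the evidence.
      ( (λ {p} _ → p)
      , λ {p} _ → subst S (sym (applyU-∘ U V p)) (J½-extend {P ∘ applyU V} (IClosed-U {P} V clP) J½⊆Q {q} Pq q∉J½ p)))
    extend : Dec (∃[ p ] (P p × ¬ J¼ p)) → UnimodImage J¼ S ⊎ UnimodImage J½ S ⊎ UnimodImage Full S
    extend (no ∄) = inj₁ (U , ≐-image U {S = S} (∄⇒⊆ {P} {J¼} ∄ , J¼⊆P))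
    extend (yes (p , Pp , p∉J¼)) with J¼-extend {P} clP J¼⊆P {p} Pp p∉J¼
    ... | V , J½⊆Q = inj₂ (extend₂ V J½⊆Q em)

  IStable⇒Free : ∀ {S} → IStable S → ¬ UnimodImage J¼ S → ¬ UnimodImage J½ S → ¬ UnimodImage Full S →
                 Free ITriple S
  IStable⇒Free {S} st ¬J¼ ¬J½ ¬Full = refute
    where
    cl : IClosed S
    cl = IStable⇒IClosed st
    refute-all : ∀ {a b c d} → Internal a b c d → S a → S b → S c → S d → ⊥
    refute-all i a b c d = [ ¬J¼ , [ ¬J½ , ¬Full ]′ ]′ (internal-classification cl i a b c d)
    refute : Free ITriple S
    refute (two-vertices-centre i) a b d = refute-all i a b (corner cl i a b d) d
    refute (vertices i) a b c            = refute-all i a b c (centre cl i a b c)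

  BStable-subset : ∀ S → BStable S → Proper S → ∀ S′ → S′ ⊆ S → BStable S′
  BStable-subset S st proper S′ S′⊆S = Free-B⇒BStable {S′} (Free-⊆ {S = S} S′⊆S (BStable⇒Free st proper))

  BIStable-subset : ∀ S → BIStable S → Proper S → ∀ S′ → S′ ⊆ S → BIStable S′
  BIStable-subset S st proper S′ S′⊆S = Free-BI⇒BIStable {S′} (Free-⊆ {S = S} S′⊆S (BIStable⇒Free st proper))

  IStable-subset : ∀ S → IStable S → ¬ UnimodImage J¼ S → ¬ UnimodImage J½ S → ¬ UnimodImage Full S →
                   ∀ S′ → S′ ⊆ S → IStable S′
  IStable-subset S st ¬J¼ ¬J½ ¬Full S′ S′⊆S = Free-I⇒IStable {S′} (Free-⊆ {S = S} S′⊆S (IStable⇒Free {S} st ¬J¼ ¬J½ ¬Full))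

  Extends : (Subset → Set) → Subset → Set₁
  Extends St S = Σ Subset λ M → Maximal St M × S ⊆ M

  -- Where stable and free mean the same for proper sets, a maximal free extension is a maximal
  -- stable one. The triple `t` of standard points ensures that free sets are proper.
  Free⇒maximal : ∀ {T} {St : Subset → Set} → T (1ℤ , 0ℤ) (0ℤ , 1ℤ) (0ℤ , 0ℤ) →
    (∀ {S} → Free T S → St S) → (∀ {S} → St S → Proper S → Free T S) →
    ∀ S → St S → Proper S → Extends St S
  Free⇒maximal {T} t stable free S st proper = greedy ,
    ( stable gfree , Free⇒Proper t gfree
    , λ S′ st′ proper′ G⊆S′ (p , p∈S′ , p∉G) → p∉G (greedy-maximal (free st′ proper′) G⊆S′ p∈S′) ) ,
    S⊆greedy
    where
    open Greedy T S
    gfree : Free T greedy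
    gfree = greedy-free (free st proper)

  BStable-maximal : ∀ S → BStable S → Proper S → Extends BStable S
  BStable-maximal = Free⇒maximal unit-BTriple Free-B⇒BStable BStable⇒Free

  BIStable-maximal : ∀ S → BIStable S → Proper S → Extends BIStable S
  BIStable-maximal = Free⇒maximal (inj₁ unit-BTriple) Free-BI⇒BIStable BIStable⇒Free

  -- The image under `U` is written as a preimage under its inverse, so that closure transfers by
  -- `IClosed-U`. The witness of properness is the image of (2,0), which lies in a coset outside
  -- `J½`.
  J½-image-maximal : ∀ U → Maximal IStable (J½ ∘ applyU (inverse U))
  J½-image-maximal U =
    IClosed⇒IStable (IClosed-U {J½} (inverse U) J½-IClosed) ,
    (applyU U (+ 2 , + 0) ,
      λ j → Coset-20∉J½ (point (0ℤ , 0ℤ) ∈₀) (subst J½ (applyU-inverseˡ U (+ 2 , + 0)) j)) ,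
    λ S′ st′ (q , q∉S′) M⊆S′ (p , p∈S′ , p∉M) → q∉S′ (subst S′ (applyU-inverseʳ U q)
      (J½-extend {S′ ∘ applyU U} (IClosed-U {S′} U (IStable⇒IClosed st′))
        (λ {x} j → M⊆S′ {applyU U x} (subst J½ (sym (applyU-inverseˡ U x)) j))
        {applyU (inverse U) p} (subst S′ (sym (applyU-inverseʳ U p)) p∈S′) p∉M (applyU (inverse U) q)))

  -- Greedy extension could fail to be maximal if a stable set that is not free contained it. All
  -- proper sets of that kind lie in images of `J½`: either `S` lies in such an image, which is
  -- maximal, or every proper stable set above `S` is free.
  IStable-maximal : ∀ S → IStable S → Proper S → Extends IStable S
  IStable-maximal S st proper with em {∃[ U ] (S ⊆ image U J½)}
  ... | yes (U , S⊆) = _ , J½-image-maximal U , λ s → inside (S⊆ s)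
    where
    inside : image U J½ ⊆ J½ ∘ applyU (inverse U)
    inside (x , j , refl) = subst J½ (sym (applyU-inverseˡ U x)) j
  ... | no ∄U = greedy ,
    ( Free-I⇒IStable gfree , Free⇒Proper unit-ITriple gfree
    , λ S′ st′ proper′ G⊆S′ (p , p∈S′ , p∉G) → p∉G (greedy-maximal (free st′ proper′ (λ s → G⊆S′ (S⊆greedy s))) G⊆S′ p∈S′) ) ,
    S⊆greedy
    where
    open Greedy ITriple S
    free : ∀ {S′} → IStable S′ → Proper S′ → S ⊆ S′ → Free ITriple S′
    free st′ (q , q∉S′) S⊆S′ = IStable⇒Free st′
      (λ (U , S′⊆ , _) → ∄U (U , λ s → widen {U} (S′⊆ (S⊆S′ s))))
      (λ (U , S′⊆ , _) → ∄U (U , λ s → S′⊆ (S⊆S′ s)))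
      (λ (U , _ , ⊆S′) → q∉S′ (⊆S′ (applyU (inverse U) q , q , applyU-inverseʳ U q)))
      where
      widen : ∀ {U} → image U J¼ ⊆ image U J½
      widen {U} (x , j , e) = x , inj₁ j , e
    gfree : Free ITriple greedy
    gfree = greedy-free (free st proper (λ s → s))

-- Aperiodic maximal sets

Periodic-translate : ∀ {S} → Periodic S → ∃[ n ] (∀ {p} v → S p → S (p ⊕ ((+ suc n) · v)))
Periodic-translate {S} (X , suc n , _ , to , from) = n , shifted
  where
  shifted : ∀ {p} v → S p → S (p ⊕ ((+ suc n) · v))
  shifted {p} (v₁ , v₂) s with to {p} s
  ... | (x₁ , x₂) , (w₁ , w₂) , x∈X , refl =
    from (_ , (w₁ + v₁ , w₂ + v₂) , x∈X , cong₂ _,_ (eq x₁ w₁ v₁) (eq x₂ w₂ v₂))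
    where
    eq : ∀ x w v → (x + + suc n * w) + + suc n * v ≡ x + + suc n * (w + v)
    eq x w v = solve 4 (λ x w v k → (x :+ k :* w) :+ k :* v := x :+ k :* (w :+ v)) refl x w v (+ suc n)

-- A period k would force (0, 4k) into a stable extension of columns, next to (±1, 4k).
data columns : Subset where
  origin : columns (0ℤ , 0ℤ)
  plus   : ∀ n → columns (1ℤ , + 4 * + suc n)
  minus  : ∀ n → columns (-1ℤ , + 4 * + suc n)

FourDivides : ℤ → Set
FourDivides z = residue₄ z ≡ 0F

columns-FourDivides : ∀ {p} → columns p → FourDivides (proj₂ p)
columns-FourDivides origin    = refl
columns-FourDivides (plus n)  = residue₄-* (+ 4) (+ suc n)
columns-FourDivides (minus n) = residue₄-* (+ 4) (+ suc n)

FourDivides-minus : ∀ x y → FourDivides x → FourDivides y → FourDivides (x - y)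
FourDivides-minus x y ex ey = trans (residue₄-minus x y) (cong₂ _-₄_ ex ey)

FourDivides-*ˡ : ∀ x y → FourDivides y → FourDivides (x * y)
FourDivides-*ˡ x y ey = trans (residue₄-* x y) (trans (cong (residue₄ x *₄_) ey) (zeroʳ (residue₄ x)))
  where
  zeroʳ : ∀ a → a *₄ 0F ≡ 0F
  zeroʳ = toWitness {a? = Finₚ.all? λ a → (a *₄ 0F) Finₚ.≟ 0F} _

orient-FourDivides : ∀ p q r → FourDivides (proj₂ p) → FourDivides (proj₂ q) → FourDivides (proj₂ r) →
                     FourDivides (orient p q r)
orient-FourDivides (p₁ , p₂) (q₁ , q₂) (r₁ , r₂) ep eq er =
  FourDivides-minus ((q₁ - p₁) * (r₂ - p₂)) ((r₁ - p₁) * (q₂ - p₂))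
    (FourDivides-*ˡ (q₁ - p₁) (r₂ - p₂) (FourDivides-minus r₂ p₂ er ep))
    (FourDivides-*ˡ (r₁ - p₁) (q₂ - p₂) (FourDivides-minus q₂ p₂ eq ep))

column-FourDivides : ∀ a c d → proj₁ a ≡ proj₁ d → FourDivides (proj₂ a) → FourDivides (proj₂ d) →
                     FourDivides (orient d c a)
column-FourDivides (a₁ , a₂) (c₁ , c₂) (_ , d₂) refl ea ed =
  FourDivides-minus ((c₁ - a₁) * (a₂ - d₂)) ((a₁ - a₁) * (c₂ - d₂))
    (FourDivides-*ˡ (c₁ - a₁) (a₂ - d₂) (FourDivides-minus a₂ d₂ ea ed))
    (cong residue₄ (trans (cong (_* (c₂ - d₂)) (ℤₚ.+-inverseʳ a₁)) (ℤₚ.*-zeroˡ (c₂ - d₂))))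

Unit-residue₄ : ∀ {z} → Unit z → residue₄ z *₄ residue₄ z ≡ 1F
Unit-residue₄ {z} (unit u) = trans (sym (residue₄-* z z)) (cong residue₄ u)

-- The factors are those of the determinants to be excluded: 1 for a unimodular triangle, 2 for the
-- vertices of a border triangle, 3 for those of an internal one.
Unit⇒¬FourDivides : ∀ {z} → Unit z → ¬ FourDivides (+ 1 * z) × ¬ FourDivides (+ 2 * z) × ¬ FourDivides (+ 3 * z)
Unit⇒¬FourDivides {z} u =
  (λ e → proj₁ (table (residue₄ z) (Unit-residue₄ u)) (trans (sym (residue₄-* (+ 1) z)) e)) ,
  (λ e → proj₁ (proj₂ (table (residue₄ z) (Unit-residue₄ u))) (trans (sym (residue₄-* (+ 2) z)) e)) ,
  (λ e → proj₂ (proj₂ (table (residue₄ z) (Unit-residue₄ u))) (trans (sym (residue₄-* (+ 3) z)) e))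
  where
  table : ∀ a → a *₄ a ≡ 1F → ¬ 1F *₄ a ≡ 0F × ¬ 2F *₄ a ≡ 0F × ¬ 3F *₄ a ≡ 0F
  table = toWitness {a? = Finₚ.all? λ a → ((a *₄ a) Finₚ.≟ 1F) →-dec
    (¬? ((1F *₄ a) Finₚ.≟ 0F) ×-dec (¬? ((2F *₄ a) Finₚ.≟ 0F) ×-dec ¬? ((3F *₄ a) Finₚ.≟ 0F)))} _

Unit⇒¬4∣ : ∀ {z} → Unit z → ¬ FourDivides z
Unit⇒¬4∣ {z} u e = proj₁ (Unit⇒¬FourDivides u) (trans (cong residue₄ (ℤₚ.*-identityˡ z)) e)

Border-orient : ∀ {a b c d} → Border a b c d → orient a b c ≡ + 2 * orient d c a
Border-orient {a₁ , a₂} {_} {c₁ , c₂} {d₁ , d₂} (border _ refl) =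
  solve 6 (λ a₁ a₂ c₁ c₂ d₁ d₂ → let a = a₁ , a₂ ; c = c₁ , c₂ ; d = d₁ , d₂ in
    orientᵖ a (((+ 2) ·ᵖ d) ⊖ᵖ a) c := con (+ 2) :* orientᵖ d c a) refl a₁ a₂ c₁ c₂ d₁ d₂

Internal-orient : ∀ {a b c d} → Internal a b c d → orient a b c ≡ + 3 * orient d a b
Internal-orient {a₁ , a₂} {b₁ , b₂} {_} {d₁ , d₂} (internal _ refl) =
  solve 6 (λ a₁ a₂ b₁ b₂ d₁ d₂ → let a = a₁ , a₂ ; b = b₁ , b₂ ; d = d₁ , d₂ in
    orientᵖ a b ((((+ 3) ·ᵖ d) ⊖ᵖ a) ⊖ᵖ b) := con (+ 3) :* orientᵖ d a b) refl a₁ a₂ b₁ b₂ d₁ d₂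

columns-orient : ∀ {p q r} → columns p → columns q → columns r → FourDivides (orient p q r)
columns-orient {p} {q} {r} cp cq cr =
  orient-FourDivides p q r (columns-FourDivides cp) (columns-FourDivides cq) (columns-FourDivides cr)

-- An edge with its midpoint has determinant 0, so divisibility by 4 must be used differently. If
-- `a` and `d` share a column, `a - d` is a vertical vector divisible by 4, and no `c` gives a unit.
-- Otherwise `b` leaves the three columns, or `d` is the origin and `b` has a negative second
-- coordinate.
columns-collinear : ∀ {a b c d} → Unit (orient d c a) → b ≡ ((+ 2) · d) ⊖ a → columns a → columns b → columns d → ⊥
columns-collinear {a} {_} {c} {d} u _ ca@origin    _ cd@origin    = Unit⇒¬4∣ u (column-FourDivides a c d refl (columns-FourDivides ca) (columns-FourDivides cd))
columns-collinear {a} {_} {c} {d} u _ ca@(plus _)  _ cd@(plus _)  = Unit⇒¬4∣ u (column-FourDivides a c d refl (columns-FourDivides ca) (columns-FourDivides cd))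
columns-collinear {a} {_} {c} {d} u _ ca@(minus _) _ cd@(minus _) = Unit⇒¬4∣ u (column-FourDivides a c d refl (columns-FourDivides ca) (columns-FourDivides cd))
columns-collinear _ e origin    origin    (plus _)  with () ← cong proj₁ e
columns-collinear _ e origin    (plus _)  (plus _)  with () ← cong proj₁ e
columns-collinear _ e origin    (minus _) (plus _)  with () ← cong proj₁ e
columns-collinear _ e origin    origin    (minus _) with () ← cong proj₁ e
columns-collinear _ e origin    (plus _)  (minus _) with () ← cong proj₁ e
columns-collinear _ e origin    (minus _) (minus _) with () ← cong proj₁ e
columns-collinear _ e (plus _)  origin    origin    with () ← cong proj₁ e
columns-collinear _ e (plus _)  (plus _)  origin    with () ← cong proj₁ e
columns-collinear _ e (plus _)  (minus _) origin    with () ← cong proj₂ e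
columns-collinear _ e (minus _) origin    origin    with () ← cong proj₁ e
columns-collinear _ e (minus _) (plus _)  origin    with () ← cong proj₂ e
columns-collinear _ e (minus _) (minus _) origin    with () ← cong proj₁ e
columns-collinear _ e (plus _)  origin    (minus _) with () ← cong proj₁ e
columns-collinear _ e (plus _)  (plus _)  (minus _) with () ← cong proj₁ e
columns-collinear _ e (plus _)  (minus _) (minus _) with () ← cong proj₁ e
columns-collinear _ e (minus _) origin    (plus _)  with () ← cong proj₁ e
columns-collinear _ e (minus _) (plus _)  (plus _)  with () ← cong proj₁ e
columns-collinear _ e (minus _) (minus _) (plus _)  with () ← cong proj₁ e

columns-free : Free BITriple columns
columns-free (inj₁ (two-ends-middle {a} {b} {c} {d} (border u e))) ca cb cd =
  columns-collinear {a} {b} {c} {d} u e ca cb cd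
columns-free (inj₁ (end-apex-middle e)) ca cc cd = Unit⇒¬4∣ (Border.border-unit e) (columns-orient cd cc ca)
columns-free (inj₁ (vertices e)) ca cb cc =
  proj₁ (proj₂ (Unit⇒¬FourDivides (Border.border-unit e)))
    (trans (cong residue₄ (sym (Border-orient e))) (columns-orient ca cb cc))
columns-free (inj₂ (two-vertices-centre i)) ca cb cd = Unit⇒¬4∣ (Internal.internal-unit i) (columns-orient cd ca cb)
columns-free (inj₂ (vertices i)) ca cb cc =
  proj₂ (proj₂ (Unit⇒¬FourDivides (Internal.internal-unit i)))
    (trans (cong residue₄ (sym (Internal-orient i))) (columns-orient ca cb cc))

opposite-points-full : ∀ {P} → BClosed P → P (1ℤ , 0ℤ) → P (-1ℤ , 0ℤ) → P (0ℤ , 0ℤ) → ∀ p → P p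
opposite-points-full cl e −e o = TriangleIn-full cl (o , e , apex cl (border (unit refl) refl) e −e o)

columns-aperiodic : ∀ {M} → BClosed M → Proper M → columns ⊆ M → ¬ Periodic M
columns-aperiodic {M} cl (q , q∉M) C⊆M periodic with Periodic-translate periodic
... | n , translate-M = q∉M (subst M (cong₂ _,_ (back (proj₁ q) 0ℤ) (back (proj₂ q) y))
        (opposite-points-full {P} (BClosed-translate {M} (0ℤ , y) cl) p⟨1,0⟩ p⟨−1,0⟩ p⟨0,0⟩ (q ⊖ (0ℤ , y))))
  where
  y : ℤ
  y = + 4 * + suc n
  P : Subset
  P = translate M (0ℤ , y)
  back : ∀ x t → (x - t) + t ≡ x
  back = solve 2 (λ x t → (x :- t) :+ t := x) refl
  p⟨0,0⟩ : P (0ℤ , 0ℤ)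
  p⟨0,0⟩ = subst M (cong₂ _,_ (solve 1 (λ k → con 0ℤ :+ k :* con 0ℤ := con 0ℤ) refl (+ suc n))
                              (solve 1 (λ k → con 0ℤ :+ k :* con (+ 4) := con 0ℤ :+ con (+ 4) :* k) refl (+ suc n)))
    (translate-M (0ℤ , + 4) (C⊆M origin))
  p⟨1,0⟩ : P (1ℤ , 0ℤ)
  p⟨1,0⟩ = C⊆M (plus n)
  p⟨−1,0⟩ : P (-1ℤ , 0ℤ)
  p⟨−1,0⟩ = C⊆M (minus n)

-- The analogue for internal triangles: a period k would force (0, 36k) into a stable extension of this set,
-- which with (1, 36k) and (−1, 36k + 3) generates J¼, and then with (10, 18) and (19, 0) the whole plane.
data tripod : Subset where
  origin : tripod (0ℤ , 0ℤ)
  right  : ∀ i k → tripod (+ (1 ℕ.+ i ℕ.* 9) , + (k ℕ.* 9))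
  left   : ∀ l → tripod (-1ℤ , + (12 ℕ.+ l ℕ.* 9))

-- The excluded values are the absolute determinants of the two kinds of `ITriple`: 1 with the
-- centre, 3 for the vertices.
record Far (p q r : Point) : Set where
  constructor far
  field
    ≢1 : ∣ orient p q r ∣ ≢ 1
    ≢3 : ∣ orient p q r ∣ ≢ 3

Far-resp : ∀ {p q r p′ q′ r′} → ∣ orient p q r ∣ ≡ ∣ orient p′ q′ r′ ∣ → Far p q r → Far p′ q′ r′
Far-resp e (far ≢1 ≢3) = far (≢1 ∘ trans e) (≢3 ∘ trans e)

Far-rotate : ∀ {p q r} → Far p q r → Far q r p
Far-rotate {p} {q} {r} = Far-resp (cong ∣_∣ (sym (orient-rotate p q r)))

Far-flip : ∀ {p q r} → Far p q r → Far q p r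
Far-flip {p} {q} {r} = Far-resp (trans (sym (ℤₚ.∣-i∣≡∣i∣ (orient p q r))) (cong ∣_∣ (sym (orient-flip p q r))))

_≡₉_ : Point → Point → Set
p ≡₉ q = ∃[ w ] q ≡ p ⊕ ((+ 9) · w)

-- If two of the points agree modulo 9, the determinant is a multiple of 9. The modulus 3 would not
-- exclude the value 3.
Far-≡₉ : ∀ {p q r} → p ≡₉ q → Far p q r
Far-≡₉ {p@(p₁ , p₂)} {_} {r@(r₁ , r₂)} (w@(w₁ , w₂) , refl) =
  far (proj₁ (multiple ∣ m ∣) ∘ trans (sym value)) (proj₂ (multiple ∣ m ∣) ∘ trans (sym value))
  where
  m : ℤ
  m = det2 w (r ⊖ p)
  value : ∣ orient p (p ⊕ ((+ 9) · w)) r ∣ ≡ ∣ m ∣ ℕ.* 9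
  value = trans (cong ∣_∣ (solve 6 (λ p₁ p₂ r₁ r₂ w₁ w₂ → let p = p₁ , p₂ ; r = r₁ , r₂ ; w = w₁ , w₂ in
      orientᵖ p (p ⊕ᵖ ((+ 9) ·ᵖ w)) r := det2ᵖ w (r ⊖ᵖ p) :* con (+ 9)) refl p₁ p₂ r₁ r₂ w₁ w₂))
    (ℤₚ.abs-* m (+ 9))
  multiple : ∀ n → n ℕ.* 9 ≢ 1 × n ℕ.* 9 ≢ 3
  multiple zero    = (λ ()) , (λ ())
  multiple (suc n) = (λ ()) , (λ ())

origin-≡₉ : (0ℤ , 0ℤ) ≡₉ (0ℤ , 0ℤ)
origin-≡₉ = (0ℤ , 0ℤ) , refl

multiple-≡₉ : ∀ s m n → + (s ℕ.+ n ℕ.* 9) ≡ + (s ℕ.+ m ℕ.* 9) + + 9 * (+ n - + m)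
multiple-≡₉ s m n = trans (cong (λ x → + s + x) (ℤₚ.pos-* n 9))
  (trans (solve 3 (λ s m n → s :+ n :* con (+ 9) := (s :+ m :* con (+ 9)) :+ con (+ 9) :* (n :- m)) refl (+ s) (+ m) (+ n))
         (cong (λ x → (+ s + x) + + 9 * (+ n - + m)) (sym (ℤₚ.pos-* m 9))))

right-≡₉ : ∀ i k i′ k′ → (+ (1 ℕ.+ i ℕ.* 9) , + (k ℕ.* 9)) ≡₉ (+ (1 ℕ.+ i′ ℕ.* 9) , + (k′ ℕ.* 9))
right-≡₉ i k i′ k′ = (+ i′ - + i , + k′ - + k) , cong₂ _,_ (multiple-≡₉ 1 i i′) (multiple-≡₉ 0 k k′)

left-≡₉ : ∀ l l′ → (-1ℤ , + (12 ℕ.+ l ℕ.* 9)) ≡₉ (-1ℤ , + (12 ℕ.+ l′ ℕ.* 9))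
left-≡₉ l l′ = (0ℤ , + l′ - + l) , cong₂ _,_ refl (multiple-≡₉ 12 l l′)

-- Modulo 9 this determinant is 3, so the congruence alone does not exclude 3. Starting the left leg
-- at height 12 instead of 3 makes it `A * B + K`, at least 12.
tripod-spread : ∀ i k l → Far (0ℤ , 0ℤ) (+ (1 ℕ.+ i ℕ.* 9) , + (k ℕ.* 9)) (-1ℤ , + (12 ℕ.+ l ℕ.* 9))
tripod-spread i k l = far ((λ ()) ∘ trans (sym (cong ∣_∣ value))) ((λ ()) ∘ trans (sym (cong ∣_∣ value)))
  where
  A B K : ℕ
  A = 1 ℕ.+ i ℕ.* 9
  B = 12 ℕ.+ l ℕ.* 9
  K = k ℕ.* 9
  value : orient (0ℤ , 0ℤ) (+ A , + K) (-1ℤ , + B) ≡ + (A ℕ.* B ℕ.+ K)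
  value = trans (solve 3 (λ A B K → (A :- con 0ℤ) :* (B :- con 0ℤ) :- (con -1ℤ :- con 0ℤ) :* (K :- con 0ℤ) := A :* B :+ K)
                  refl (+ A) (+ B) (+ K))
                (cong (_+ + K) (sym (ℤₚ.pos-* A B)))

tripod-far : ∀ {p q r} → tripod p → tripod q → tripod r → Far p q r
tripod-far origin       origin       _            = Far-≡₉ origin-≡₉
tripod-far (right i k)  (right j l)  _            = Far-≡₉ (right-≡₉ i k j l)
tripod-far (left l)     (left m)     _            = Far-≡₉ (left-≡₉ l m)
tripod-far origin       (right _ _)  origin       = Far-rotate (Far-≡₉ origin-≡₉)
tripod-far origin       (right i k)  (right j l)  = Far-rotate (Far-rotate (Far-≡₉ (right-≡₉ i k j l)))
tripod-far origin       (right i k)  (left l)     = tripod-spread i k l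
tripod-far origin       (left _)     origin       = Far-rotate (Far-≡₉ origin-≡₉)
tripod-far origin       (left l)     (left m)     = Far-rotate (Far-rotate (Far-≡₉ (left-≡₉ l m)))
tripod-far origin       (left l)     (right i k)  = Far-rotate (Far-flip (tripod-spread i k l))
tripod-far (right _ _)  origin       origin       = Far-rotate (Far-rotate (Far-≡₉ origin-≡₉))
tripod-far (right i k)  origin       (right j l)  = Far-rotate (Far-≡₉ (right-≡₉ j l i k))
tripod-far (right i k)  origin       (left l)     = Far-flip (tripod-spread i k l)
tripod-far (right i k)  (left l)     origin       = Far-rotate (tripod-spread i k l)
tripod-far (right i k)  (left l)     (right j m)  = Far-rotate (Far-≡₉ (right-≡₉ j m i k))
tripod-far (right i k)  (left l)     (left m)     = Far-rotate (Far-rotate (Far-≡₉ (left-≡₉ l m)))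
tripod-far (left _)     origin       origin       = Far-rotate (Far-rotate (Far-≡₉ origin-≡₉))
tripod-far (left l)     origin       (right i k)  = Far-rotate (Far-rotate (tripod-spread i k l))
tripod-far (left l)     origin       (left m)     = Far-rotate (Far-≡₉ (left-≡₉ m l))
tripod-far (left l)     (right i k)  origin       = Far-flip (Far-rotate (tripod-spread i k l))
tripod-far (left l)     (right i k)  (right j m)  = Far-rotate (Far-rotate (Far-≡₉ (right-≡₉ i k j m)))
tripod-far (left l)     (right i k)  (left m)     = Far-rotate (Far-≡₉ (left-≡₉ m l))

Unit-abs : ∀ z → Unit z → ∣ z ∣ ≡ 1
Unit-abs z u with Unit⇒±1 z u
... | inj₁ refl = refl
... | inj₂ refl = refl

tripod-free : Free ITriple tripod
tripod-free (two-vertices-centre {a} {b} {c} {d} i) ta tb td =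
  Far.≢1 (tripod-far td ta tb) (Unit-abs _ (Internal.internal-unit i))
tripod-free (vertices {a} {b} {c} {d} i) ta tb tc = Far.≢3 (tripod-far ta tb tc)
  (trans (cong ∣_∣ (Internal-orient i)) (trans (ℤₚ.abs-* (+ 3) (orient d a b))
    (cong (3 ℕ.*_) (Unit-abs _ (Internal.internal-unit i)))))

-- The three given points have determinant 3 and centroid (0,1); the origin is then the centre of
-- the standard triangle, whose last vertex is (-1,-1).
scaled-triangle-ΔIn : ∀ {P} → IClosed P → P (0ℤ , 0ℤ) → P (1ℤ , 0ℤ) → P (-1ℤ , + 3) → ΔIn P
scaled-triangle-ΔIn {P} cl o e p⟨−1,3⟩ = o , e , p⟨0,1⟩ , third cl (unit refl) e p⟨0,1⟩ o
  where
  p⟨0,1⟩ : P (0ℤ , 1ℤ)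
  p⟨0,1⟩ = centre cl (internal (unit refl) refl) e p⟨−1,3⟩ o

-- The shift `y` is a multiple of 36 = 4 * 9: of 9, to land on points of both legs, and of 4, to
-- preserve residues modulo 4. The right leg has horizontal spacing 9, coprime to 4, so it also
-- reaches the residues (2,2), through (10,18), and (3,0), through (19,0): one point in each of two
-- further cosets.
tripod-aperiodic : ∀ {M} → IClosed M → Proper M → tripod ⊆ M → ¬ Periodic M
tripod-aperiodic {M} cl (q , q∉M) T⊆M periodic with Periodic-translate periodic
... | n , translate-M = q∉M (subst M (cong₂ _,_ (back (proj₁ q) 0ℤ) (back (proj₂ q) y))
        (J½-extend {P} clP J½⊆P {+ 19 , -1ℤ * y} p⟨19,−y⟩ (Coset-20∉J½ c⟨19,−y⟩) (q ⊖ (0ℤ , y))))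
  where
  k y : ℤ
  k = + suc n
  y = + 36 * k
  P : Subset
  P = translate M (0ℤ , y)
  clP : IClosed P
  clP = IClosed-translate {M} (0ℤ , y) cl
  back : ∀ x t → (x - t) + t ≡ x
  back = solve 2 (λ x t → (x :- t) :+ t := x) refl
  p⟨0,0⟩ : P (0ℤ , 0ℤ)
  p⟨0,0⟩ = subst M (cong₂ _,_ (solve 1 (λ k → con 0ℤ :+ k :* con 0ℤ := con 0ℤ) refl k)
                              (solve 1 (λ k → con 0ℤ :+ k :* con (+ 36) := con 0ℤ :+ con (+ 36) :* k) refl k))
    (translate-M (0ℤ , + 36) (T⊆M origin))
  p⟨1,0⟩ : P (1ℤ , 0ℤ)
  p⟨1,0⟩ = subst M (cong (1ℤ ,_) (trans (ℤₚ.pos-* (suc n ℕ.* 4) 9) (trans (cong (_* + 9) (ℤₚ.pos-* (suc n) 4))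
      (solve 1 (λ k → (k :* con (+ 4)) :* con (+ 9) := con 0ℤ :+ con (+ 36) :* k) refl k))))
    (T⊆M (right 0 (suc n ℕ.* 4)))
  p⟨−1,3⟩ : P (-1ℤ , + 3)
  -- The index solves `12 + 9 l = 36 (n + 1) + 3`, that is, `l = 3 + 4 n`.
  p⟨−1,3⟩ = subst M (cong (-1ℤ ,_) (trans (cong (λ x → + 12 + x)
        (trans (ℤₚ.pos-* (3 ℕ.+ n ℕ.* 4) 9) (cong (λ x → (+ 3 + x) * + 9) (ℤₚ.pos-* n 4))))
      (solve 1 (λ n → con (+ 12) :+ (con (+ 3) :+ n :* con (+ 4)) :* con (+ 9)
                      := con (+ 3) :+ con (+ 36) :* (con (+ 1) :+ n)) refl (+ n))))
    (T⊆M (left (3 ℕ.+ n ℕ.* 4)))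
  J¼⊆P : J¼ ⊆ P
  J¼⊆P = J¼-fill {P} clP (scaled-triangle-ΔIn {P} clP p⟨0,0⟩ p⟨1,0⟩ p⟨−1,3⟩)
  shift-back : ∀ x → x ≡ (x + -1ℤ * y) + y
  shift-back x = solve 2 (λ x y → x := (x :+ con -1ℤ :* y) :+ y) refl x y
  p⟨10,18−y⟩ : P (+ 10 , + 18 + -1ℤ * y)
  p⟨10,18−y⟩ = subst M (cong (+ 10 ,_) (shift-back (+ 18))) (T⊆M (right 1 2))
  c⟨10,18−y⟩ : Coset (+ 2 , + 2) (+ 10 , + 18 + -1ℤ * y)
  c⟨10,18−y⟩ = subst (Coset (+ 2 , + 2)) (cong (+ 10 ,_)
      (solve 1 (λ k → con (+ 2) :+ con (+ 4) :* (con (+ 4) :- con (+ 9) :* k) := con (+ 18) :+ con -1ℤ :* (con (+ 36) :* k)) refl k))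
    (point (+ 2 , + 4 - + 9 * k) ∈₀)
  p⟨19,−y⟩ : P (+ 19 , -1ℤ * y)
  p⟨19,−y⟩ = subst M (cong (+ 19 ,_) (solve 1 (λ y → con 0ℤ := con -1ℤ :* y :+ y) refl y)) (T⊆M (right 2 0))
  c⟨19,−y⟩ : Coset (+ 2 , + 0) (+ 19 , -1ℤ * y)
  c⟨19,−y⟩ = subst (Coset (+ 2 , + 0)) (cong (+ 19 ,_)
      (solve 1 (λ k → con 0ℤ :+ con (+ 4) :* (con -[1+ 8 ] :* k) := con -1ℤ :* (con (+ 36) :* k)) refl k))
    (point (+ 4 , -[1+ 8 ] * k) ∈₁)
  J½⊆P : J½ ⊆ P
  J½⊆P (inj₁ j) = J¼⊆P j
  J½⊆P {x} (inj₂ j) = Coset-22-fill {P} clP J¼⊆P c⟨10,18−y⟩ p⟨10,18−y⟩ (J¼⇒Coset _ x j)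

module Aperiodic (em : ExcludedMiddle 0ℓ) where
  open Classical em

  aperiodic-B : Σ Subset λ S → Maximal BStable S × ¬ Periodic S
  aperiodic-B with BStable-maximal columns (Free-B⇒BStable free) (Free⇒Proper unit-BTriple free)
    where
    free : Free BTriple columns
    free t = columns-free (inj₁ t)
  ... | M , max@(st , proper , _) , C⊆M = M , max , columns-aperiodic (BStable⇒BClosed st) proper C⊆M

  aperiodic-BI : Σ Subset λ S → Maximal BIStable S × ¬ Periodic S
  aperiodic-BI with BIStable-maximal columns (Free-BI⇒BIStable columns-free) (Free⇒Proper (inj₁ unit-BTriple) columns-free)
  ... | M , max@((st , _) , proper , _) , C⊆M = M , max , columns-aperiodic (BStable⇒BClosed st) proper C⊆M

  aperiodic-I : Σ Subset λ S → Maximal IStable S × ¬ Periodic S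
  aperiodic-I with IStable-maximal tripod (Free-I⇒IStable tripod-free) (Free⇒Proper unit-ITriple tripod-free)
  ... | M , max@(st , proper , _) , T⊆M = M , max , tripod-aperiodic (IStable⇒IClosed st) proper T⊆M

theorem1p4 : ExcludedMiddle 0ℓ →
    ((∀ (S : Subset) → BStable S → Proper S → ∀ (S′ : Subset) → S′ ⊆ S → BStable S′) ×
    (∀ (S : Subset) → BIStable S → Proper S → ∀ (S′ : Subset) → S′ ⊆ S → BIStable S′)) ×
    (∀ (S : Subset) → IStable S →
    ¬ UnimodImage J¼ S → ¬ UnimodImage J½ S → ¬ UnimodImage Full S →
    ∀ (S′ : Subset) → S′ ⊆ S → IStable S′) ×
    ((∀ (S : Subset) → BStable S → Proper S → Σ Subset λ M → Maximal BStable M × S ⊆ M) ×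
    (∀ (S : Subset) → IStable S → Proper S → Σ Subset λ M → Maximal IStable M × S ⊆ M) ×
    (∀ (S : Subset) → BIStable S → Proper S → Σ Subset λ M → Maximal BIStable M × S ⊆ M)) ×
    ((Σ Subset λ S → Maximal BStable S × ¬ Periodic S) ×
    (Σ Subset λ S → Maximal IStable S × ¬ Periodic S) ×
    (Σ Subset λ S → Maximal BIStable S × ¬ Periodic S))
theorem1p4 em =
  (BStable-subset , BIStable-subset) , IStable-subset ,
  (BStable-maximal , IStable-maximal , BIStable-maximal) ,
  (aperiodic-B , aperiodic-I , aperiodic-BI)
  where
  open Classical em
  open Aperiodic em
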